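{- Let $F$ and $F'$ be connected open 2-digraphs all of whose alternating cycles are odd, each having exactly $n>0$ exit vertices (hence $n$ entry vertices). Label the entry vertices and the exit vertices of each of $F,F'$ by $1,\dots,n$, and let $P,Q\subseteq S_n$ be the sets of permutations corresponding to the open routes of $F$ and $F'$ respectively. Let $x,y\in S_n$ and let $G=\mathcal{S}(F,F',x,y)$ be the spliced 2-dd. Assume that $(n,P,Q,x,y)$ satisfies the parity condition. Then the following are equivalent: (i) $G$ is non-Hamiltonian; (ii) $xQy\subseteq R_P$; (iii) $yPx\subseteq R_Q$.
   Context: **Permutations.** $S_n$ is the symmetric group on $\{1,\dots,n\}$, $A_n$ the set of even permutations, $\overline{A}_n=S_n-A_n$ the set of odd ones, and $C_n\subset S_n$ the set of permutations consisting of a single cycle of length $n$. Products are composed from left to right, so $pxqy$ maps $i$ to $y(q(x(p(i))))$. A set $P\subseteq S_n$ is uniform if it is non-empty and either $P\subseteq A_n$ (even, $\pi(P)=0$) or $P\subseteq\overline{A}_n$ (odd, $\pi(P)=1$). For a permutation $p$, $\pi(p)=0$ if $p$ is even and $1$ if odd; for an integer $n$, $\pi(n)=0$ if $n$ is even and $1$ if odd. For sets, $xQy=\{xqy: q\in Q\}$ and $P^{ -1}C_n=\{p^{ -1}c: p\in P, c\in C_n\}$. For uniform $P$, the excluded set is $E_P=P^{ -1}C_n$ and the residue is $R_P=\overline{A}_n-E_P$ if $\pi(P)=\pi(n)$, and $R_P=A_n-E_P$ otherwise. **Parity condition** for $(n,P,Q,x,y)$: one of the following holds: (1) $\pi(n)=0$,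 $\pi(P)=\pi(Q)$, $\pi(x)\ne\pi(y)$; (2) $\pi(n)=0$, $\pi(P)\neq\pi(Q)$, $\pi(x)=\pi(y)$; (3) $\pi(n)=1$, $\pi(P)=\pi(Q)$, $\pi(x)=\pi(y)$; (4) $\pi(n)=1$, $\pi(P)\ne\pi(Q)$, $\pi(x)\neq\pi(y)$. **Graphs.** A 2-digraph is a finite digraph in which each vertex has (in-degree, out-degree) equal to $(0,2)$ (an entry vertex), $(2,0)$ (an exit vertex) or $(2,2)$ (a saturated vertex). A 2-dd is a 2-digraph all of whose vertices are saturated. Connected means that the underlying undirected graph is connected. An alternating cycle (AC) is a sequence of $2r$ distinct arcs $(e_0,\dots,e_{2r-1})$ such that $e_i$ and $e_{i+1}$ (indices mod $2r$) have a common end-vertex if $i$ is even and a common start-vertex if $i$ is odd; its forward arcs are the $e_i$ with $i$ even and its backward arcs those with $i$ odd. The AC is odd if $r$ is odd. The arc set of a 2-digraph is uniquely partitioned into ACs. A factor of a 2-digraph is a spanning subgraph which, for every AC, contains either all its forward arcs and none of its backward arcs, or vice versa; it is a disjoint union of simple directed cycles and simple directed paths from entry vertices to exit vertices. A factor is open if it contains no cycle; a 2-digraph is open if it has at least one open factor. The route of a factor is the bijection from entry vertices to exit vertices sending each entry vertex to the end of the path of the factor starting there; a route is open if it is the route of at least one open factor. With entry and exit vertices labelled by $1,\dots,n$, a route is a permutation in $S_n$. When all ACs are odd, the set of open routes of an open 2-digraph is uniform. **Splicing.** $\mathcal{S}(F,F',x,y)$ is the 2-dd obtained from the disjoint union of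 $F$ and $F'$ by identifying, for each $i$, exit vertex $i$ of $F$ with entry vertex $x(i)$ of $F'$, and exit vertex $i$ of $F'$ with entry vertex $y(i)$ of $F$. A 2-dd is Hamiltonian if it has a directed cycle through all vertices. -}

module Defs where

open import Data.Bool.Base using (Bool; true; false; if_then_else_)
open import Data.Fin.Base using (Fin; toℕ)
import Data.Fin.Properties as Fin
open import Data.Fin.Permutation using (Permutation′; _⟨$⟩ʳ_; _∘ₚ_; flip; _≈_)
open import Data.List.Base using (length; filter; allFin; cartesianProduct)
open import Data.Nat.Base using (ℕ; suc; _>_; parity)
open import Data.Nat.DivMod using (_mod_)
open import Data.Parity.Base using (Parity; 0ℙ; 1ℙ)
import Data.Parity.Properties as Parity
open import Data.Product.Base using (_×_; _,_; ∃; ∃₂)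
open import Data.Sum.Base using (_⊎_; inj₁; inj₂)
import Data.Sum.Base as Sum
open import Level using (0ℓ)
open import Relation.Binary.Bundles using (Setoid)
open import Relation.Binary.Construct.Closure.Equivalence as Eq using (EqClosure)
open import Relation.Binary.Construct.Closure.ReflexiveTransitive using (Star)
open import Relation.Binary.PropositionalEquality.Core using (_≡_; _≢_)
open import Relation.Binary.PropositionalEquality.Properties using (setoid)
open import Relation.Nullary.Decidable using (does; _×-dec_)
open import Relation.Nullary.Negation using (¬_)
open import Relation.Unary using (Pred; _∈_; _∖_)

private
  variable
    n : ℕ

-- i ↦ i + 1 mod n
next : Fin n → Fin n
next {suc n} i = suc (toℕ i) mod suc n

-- The elements satisfying P, up to the equality of S, are exactly
-- at 0 , … , at (k - 1), without repetition.
record Enumeration (S : Setoid 0ℓ 0ℓ) (P : Pred (Setoid.Carrier S) 0ℓ) (k : ℕ) : Set where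
  open Setoid S renaming (_≈_ to _∼_)
  field
    at        : Fin k → Carrier
    injective : ∀ {i j} → at i ∼ at j → i ≡ j
    sound     : ∀ i → P (at i)
    complete  : ∀ {a} → P a → ∃ λ i → at i ∼ a

PermSet : ℕ → Set₁
PermSet n = Pred (Permutation′ n) 0ℓ

inversions : Permutation′ n → ℕ
inversions {n} σ = length (filter
  (λ (i , j) → (i Fin.<? j) ×-dec ((σ ⟨$⟩ʳ j) Fin.<? (σ ⟨$⟩ʳ i)))
  (cartesianProduct (allFin n) (allFin n)))

π : Permutation′ n → Parity
π σ = parity (inversions σ)

Even Odd : PermSet n
Even σ = π σ ≡ 0ℙ
Odd  σ = π σ ≡ 1ℙ

-- σ is the cycle (c 0  c 1  …  c (n - 1)).
FullCycle : PermSet n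
FullCycle {n} σ = ∃ λ (c : Permutation′ n) → ∀ i → σ ⟨$⟩ʳ (c ⟨$⟩ʳ i) ≡ c ⟨$⟩ʳ next i

-- _∘ₚ_ composes from left to right: σ ∘ₚ τ maps i to τ (σ i).

-- x Q y
translate : Permutation′ n → PermSet n → Permutation′ n → PermSet n
translate x Q y σ = ∃ λ q → q ∈ Q × σ ≈ (x ∘ₚ q ∘ₚ y)

-- E_P = P⁻¹ C_n
Excluded : PermSet n → PermSet n
Excluded P σ = ∃₂ λ p c → p ∈ P × c ∈ FullCycle × σ ≈ (flip p ∘ₚ c)

-- The parity of a uniform set is determined by the set, since the set is
-- inhabited.
record Uniform (P : PermSet n) : Set where
  field
    parityOf : Parity
    nonEmpty : ∃ λ p → p ∈ P
    uniform  : ∀ {p} → p ∈ P → π p ≡ parityOf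

open Uniform public using (parityOf)

-- R_P
Residue : (P : PermSet n) → Uniform P → PermSet n
Residue {n} P uP =
  if does (parityOf uP Parity.≟ parity n)
  then Odd ∖ Excluded P
  else Even ∖ Excluded P

ParityCondition : (n : ℕ) {P Q : PermSet n} → Uniform P → Uniform Q →
                  (x y : Permutation′ n) → Set
ParityCondition n uP uQ x y
  = (parity n ≡ 0ℙ × parityOf uP ≡ parityOf uQ × π x ≢ π y)
  ⊎ (parity n ≡ 0ℙ × parityOf uP ≢ parityOf uQ × π x ≡ π y)
  ⊎ (parity n ≡ 1ℙ × parityOf uP ≡ parityOf uQ × π x ≡ π y)
  ⊎ (parity n ≡ 1ℙ × parityOf uP ≢ parityOf uQ × π x ≢ π y)

-- Loops and parallel arcs are allowed.  Vertices form a setoid so that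
-- vertices can be identified.
record Digraph : Set₁ where
  field
    vertices : Setoid 0ℓ 0ℓ
    Arc      : Set
  open Setoid vertices public using () renaming (Carrier to Vertex; _≈_ to _∼_)
  field
    start end : Arc → Vertex

finite : ∀ {v a} → (Fin a → Fin v) → (Fin a → Fin v) → Digraph
finite {v} {a} s e = record
  { vertices = setoid (Fin v) ; Arc = Fin a ; start = s ; end = e }

module _ (D : Digraph) where
  open Digraph D

  InDegree OutDegree : Vertex → ℕ → Set
  InDegree  v = Enumeration (setoid Arc) (λ e → end e ∼ v)
  OutDegree v = Enumeration (setoid Arc) (λ e → start e ∼ v)

  IsEntry IsExit IsSaturated : Vertex → Set
  IsEntry     v = InDegree v 0 × OutDegree v 2
  IsExit      v = InDegree v 2 × OutDegree v 0
  IsSaturated v = InDegree v 2 × OutDegree v 2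

  Connected : Set
  Connected = ∀ u v →
    EqClosure (λ a b → a ∼ b ⊎ ∃ λ e → start e ∼ a × end e ∼ b) u v

  -- The sequence (e₀ , … , e₂ᵣ₋₁) is split as e₂ᵢ = forward i and
  -- e₂ᵢ₊₁ = backward i.
  record AlternatingCycle : Set where
    field
      r         : ℕ
      r>0       : r > 0
      forward   : Fin r → Arc
      backward  : Fin r → Arc
      forward-injective  : ∀ {i j} → forward i ≡ forward j → i ≡ j
      backward-injective : ∀ {i j} → backward i ≡ backward j → i ≡ j
      forward≢backward   : ∀ i j → forward i ≢ backward j
      common-end         : ∀ i → end (forward i) ∼ end (backward i)
      common-start       : ∀ i → start (backward i) ∼ start (forward (next i))

  AllACsOdd : Set
  AllACsOdd = ∀ (C : AlternatingCycle) → parity (AlternatingCycle.r C) ≡ 1ℙ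

  -- A spanning subgraph is given by its set of arcs.
  SpanningSubgraph : Set
  SpanningSubgraph = Arc → Bool

  IsFactor : SpanningSubgraph → Set
  IsFactor K = ∀ (C : AlternatingCycle) → let open AlternatingCycle C in
      (∀ i → K (forward i) ≡ true × K (backward i) ≡ false)
    ⊎ (∀ i → K (forward i) ≡ false × K (backward i) ≡ true)

  record DirectedCycle : Set where
    field
      {length-1} : ℕ
      arc        : Fin (suc length-1) → Arc
      consecutive : ∀ i → end (arc i) ∼ start (arc (next i))
      simple      : ∀ {i j} → start (arc i) ∼ start (arc j) → i ≡ j

  IsOpenFactor : SpanningSubgraph → Set
  IsOpenFactor K = IsFactor K ×
    ¬ (∃ λ (Z : DirectedCycle) → ∀ i → K (DirectedCycle.arc Z i) ≡ true)

  Open : Set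
  Open = ∃ λ K → IsOpenFactor K

  Path : SpanningSubgraph → Vertex → Vertex → Set
  Path K = Star (λ a b → ∃ λ e → K e ≡ true × start e ∼ a × end e ∼ b)

  Hamiltonian : Set
  Hamiltonian = ∃ λ (Z : DirectedCycle) →
    ∀ v → ∃ λ i → start (DirectedCycle.arc Z i) ∼ v

record TwoDigraph (n : ℕ) : Set where
  field
    {∣V∣ ∣A∣} : ℕ
    start end : Fin ∣A∣ → Fin ∣V∣

  digraph : Digraph
  digraph = finite start end

  field
    degrees : ∀ v → IsEntry digraph v ⊎ IsExit digraph v ⊎ IsSaturated digraph v
    entries : Enumeration (setoid (Fin ∣V∣)) (IsEntry digraph) n
    exits   : Enumeration (setoid (Fin ∣V∣)) (IsExit digraph) n

  entry exit : Fin n → Fin ∣V∣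
  entry = Enumeration.at entries
  exit  = Enumeration.at exits

module _ (F : TwoDigraph n) where
  open TwoDigraph F

  -- Walks in a factor are determined by their first vertex, as a factor has
  -- at most one arc starting at each vertex.
  IsRoute : SpanningSubgraph digraph → PermSet n
  IsRoute K p = ∀ i → Path digraph K (entry i) (exit (p ⟨$⟩ʳ i))

  OpenRoutes : PermSet n
  OpenRoutes p = ∃ λ K → IsOpenFactor digraph K × IsRoute K p

module _ (F F′ : TwoDigraph n) (x y : Permutation′ n) where
  private
    module F  = TwoDigraph F
    module F′ = TwoDigraph F′

  data Glue : Fin F.∣V∣ ⊎ Fin F′.∣V∣ → Fin F.∣V∣ ⊎ Fin F′.∣V∣ → Set where
    exit-entry′ : ∀ i → Glue (inj₁ (F.exit i)) (inj₂ (F′.entry (x ⟨$⟩ʳ i)))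
    exit′-entry : ∀ i → Glue (inj₂ (F′.exit i)) (inj₁ (F.entry (y ⟨$⟩ʳ i)))

  splice : Digraph
  splice = record
    { vertices = Eq.setoid Glue
    ; Arc      = Fin F.∣A∣ ⊎ Fin F′.∣A∣
    ; start    = Sum.map F.start F′.start
    ; end      = Sum.map F.end F′.end
    }

{-
For a factor K of F, following K and jumping from exit i to entry i is a
permutation Φ_K of the vertices, and when K is open its first return to the
exit vertices is, up to this jump, the route of K.  Passing to a first return
cuts out one vertex at a time, each time multiplying by a transposition, so the
sign of the route is that of Φ_K times a sign which depends only on the numbers
of vertices and of exits.  For two factors K and L the permutation
Φ_L⁻¹ ∘ Φ_K moves the vertices along the alternating cycles on which K and L
differ; these are odd, so Φ_L⁻¹ ∘ Φ_K is even and the open routes form a uniform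
set.

A Hamiltonian cycle of the splice restricts to open factors of F and F′, and
following it from entry vertex to entry vertex of F shows that p x q y is a
full cycle, where p and q are the routes of these factors.  Conversely, open
factors whose routes make p x q y a full cycle join into a Hamiltonian cycle.
So G is non-Hamiltonian iff no p x q y, with p in P and q in Q, is a full
cycle.  The parity condition gives x q y the parity that R_P requires, hence
this says that x Q y avoids E_P, that is, lies in R_P; and p x q y is conjugate
to q y p x, which makes the criterion symmetric.
-}
module Submission where

open import Defs
open import Algebra.Properties.CommutativeMonoid.Sum as Sum using ()
open import Data.Bool.Base using (Bool; true; false; if_then_else_; _∧_; not)
import Data.Bool.Properties as Bool
open import Data.Fin.Base using (Fin; zero; suc; toℕ; fromℕ; inject₁; punchOut; join; splitAt)
import Data.Fin.Induction as Fin
import Data.Fin.Properties as Fin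
open import Data.Fin.Permutation
  using (Permutation′; Permutation; _⟨$⟩ʳ_; _⟨$⟩ˡ_; _∘ₚ_; flip; _≈_; id; lift₀;
         swap; transpose; inverseˡ; inverseʳ; remove; lift₀-remove; ↔⇒≡; permutation)
import Data.Fin.Permutation.Components as PC
open import Data.Fin.Relation.Unary.Top using (view; ‵fromℕ; ‵inject₁)
open import Data.List.Base as List using (length; filter; cartesianProduct; tabulate)
import Data.List.Properties as List
open import Data.Nat.Base as ℕ using (ℕ; zero; suc; _+_; _*_; _>_; _≤_; _<_; s≤s; z≤n; s<s; parity)
open import Data.Nat.GeneralisedArithmetic using (fold; fold-+)
import Data.Nat.DivMod as ℕ
import Data.Nat.Properties as ℕ
open import Data.Parity.Base as ℙ using (Parity; 0ℙ; 1ℙ; _⁻¹)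
import Data.Parity.Properties as ℙ
open import Data.Product.Base using (_×_; _,_; ∃; ∃₂; proj₁; proj₂; Σ-syntax)
open import Data.Sum.Base as Sum⊎ using (_⊎_; inj₁; inj₂; [_,_]′)
import Data.Sum.Properties as Sum⊎
open import Function.Base using (_∘_)
open import Function.Bundles using (_⇔_; mk⇔)
open import Function.Definitions using (Injective)
open import Level using (0ℓ)
open import Relation.Binary.Bundles using (Setoid)
open import Relation.Binary.Construct.Closure.Equivalence as Eq using (EqClosure)
open import Relation.Binary.Construct.Closure.ReflexiveTransitive using (ε; _◅_)
open import Relation.Binary.Definitions using (tri<; tri≈; tri>)
open import Relation.Binary.PropositionalEquality hiding ([_])
open import Relation.Binary.Structures using (IsEquivalence)
open import Relation.Nullary.Decidable using (Dec; yes; no; does; ¬?; _×-dec_; dec-true; dec-false)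
open import Relation.Nullary.Negation using (¬_; contradiction)
open import Relation.Unary using (Pred; Decidable; _∈_; _⊆_)
open Sum ℕ.+-0-commutativeMonoid using (sum; sum-cong-≗; ∑-distrib-+; ∑-comm; ∑-permute; sum-replicate-zero)
open ≡-Reasoning

private
  variable
    m n : ℕ

-- Signs of permutations

injective : (σ : Permutation m n) → ∀ {i j} → σ ⟨$⟩ʳ i ≡ σ ⟨$⟩ʳ j → i ≡ j
injective σ eq = trans (sym (inverseˡ σ)) (trans (cong (σ ⟨$⟩ˡ_) eq) (inverseˡ σ))

bit : Bool → ℕ
bit b = if b then 1 else 0

length-filter-tabulate : ∀ {A : Set} {P : Pred A 0ℓ} (P? : Decidable P) (f : Fin n → A) →
  length (filter P? (tabulate f)) ≡ sum (λ i → bit (does (P? (f i))))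
length-filter-tabulate {zero}  P? f = refl
length-filter-tabulate {suc n} P? f with does (P? (f zero))
... | true  = cong suc (length-filter-tabulate P? (f ∘ suc))
... | false = length-filter-tabulate P? (f ∘ suc)

length-filter-cartesianProduct : ∀ {A B : Set} {P : Pred (A × B) 0ℓ} (P? : Decidable P)
  (f : Fin m → A) (g : Fin n → B) →
  length (filter P? (cartesianProduct (tabulate f) (tabulate g))) ≡
  sum (λ i → sum (λ j → bit (does (P? (f i , g j)))))
length-filter-cartesianProduct {zero}  P? f g = refl
length-filter-cartesianProduct {suc m} P? f g = begin
  length (filter P? (List.map (f zero ,_) (tabulate g) List.++ rest))
    ≡⟨ cong length (List.filter-++ P? (List.map (f zero ,_) (tabulate g)) rest) ⟩
  length (filter P? (List.map (f zero ,_) (tabulate g)) List.++ filter P? rest)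
    ≡⟨ List.length-++ (filter P? (List.map (f zero ,_) (tabulate g))) ⟩
  length (filter P? (List.map (f zero ,_) (tabulate g))) + length (filter P? rest)
    ≡⟨ cong₂ _+_ (trans (cong (length ∘ filter P?) (List.map-tabulate g (f zero ,_)))
                        (length-filter-tabulate P? (λ j → f zero , g j)))
                 (length-filter-cartesianProduct P? (f ∘ suc) g) ⟩
  _ ∎
  where rest = cartesianProduct (tabulate (f ∘ suc)) (tabulate g)

∑∑ : (Fin m → Fin n → ℕ) → ℕ
∑∑ h = sum (λ i → sum (h i))

∑∑-cong : {g h : Fin m → Fin n → ℕ} → (∀ i j → g i j ≡ h i j) → ∑∑ g ≡ ∑∑ h
∑∑-cong g≗h = sum-cong-≗ (λ i → sum-cong-≗ (g≗h i))

∑∑-distrib-+ : (g h : Fin m → Fin n → ℕ) → ∑∑ (λ i j → g i j + h i j) ≡ ∑∑ g + ∑∑ h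
∑∑-distrib-+ g h = trans (sum-cong-≗ (λ i → ∑-distrib-+ (g i) (h i)))
                         (∑-distrib-+ (λ i → sum (g i)) (λ i → sum (h i)))

∑∑-permute : (σ : Permutation′ n) (h : Fin n → Fin n → ℕ) →
  ∑∑ h ≡ ∑∑ (λ i j → h (σ ⟨$⟩ʳ i) (σ ⟨$⟩ʳ j))
∑∑-permute σ h = trans (∑-permute (λ i → sum (h i)) σ)
                       (sum-cong-≗ (λ i → ∑-permute (h (σ ⟨$⟩ʳ i)) σ))

sum-zero : {f : Fin n → ℕ} → (∀ i → f i ≡ 0) → sum f ≡ 0
sum-zero {n} f≗0 = trans (sum-cong-≗ f≗0) (sum-replicate-zero n)

parity-sum-cong : {f g : Fin n → ℕ} → (∀ i → parity (f i) ≡ parity (g i)) →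
  parity (sum f) ≡ parity (sum g)
parity-sum-cong {zero}          f≗g = refl
parity-sum-cong {suc n} {f} {g} f≗g = begin
  parity (f zero + sum (f ∘ suc))
    ≡⟨ ℙ.+-homo-+ (f zero) _ ⟩
  parity (f zero) ℙ.+ parity (sum (f ∘ suc))
    ≡⟨ cong₂ ℙ._+_ (f≗g zero) (parity-sum-cong (f≗g ∘ suc)) ⟩
  parity (g zero) ℙ.+ parity (sum (g ∘ suc))
    ≡⟨ ℙ.+-homo-+ (g zero) _ ⟨
  parity (g zero + sum (g ∘ suc)) ∎

lt : Fin n → Fin n → Bool
lt i j = does (i Fin.<? j)

-- Indexed by both comparison bits, so that matching on it after abstracting `lt i j` and `lt j i`
-- makes `inv` and `rev` compute and leaves three cases instead of four.
data Cmp (i j : Fin n) : Bool → Bool → Set where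
  below : i ≢ j → Cmp i j true false
  equal : i ≡ j → Cmp i j false false
  above : i ≢ j → Cmp i j false true

compare : (i j : Fin n) → Cmp i j (lt i j) (lt j i)
compare i j with Fin.<-cmp i j
... | tri< i<j i≢j i≯j
  rewrite dec-true (i Fin.<? j) i<j | dec-false (j Fin.<? i) i≯j = below i≢j
... | tri≈ i≮j i≡j i≯j
  rewrite dec-false (i Fin.<? j) i≮j | dec-false (j Fin.<? i) i≯j = equal i≡j
... | tri> i≮j i≢j i>j
  rewrite dec-false (i Fin.<? j) i≮j | dec-true (j Fin.<? i) i>j = above i≢j

lt-irrefl : (i : Fin n) → lt i i ≡ false
lt-irrefl i = dec-false (i Fin.<? i) (Fin.<-irrefl refl)

inv : (Fin n → Fin n) → Fin n → Fin n → ℕ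
inv f i j = bit (lt i j ∧ lt (f j) (f i))

-- The symmetrised form of `inv`: it is 1 when `f` reverses the order of `i` and `j`, whichever of
-- them is smaller, and 0 otherwise.
rev : (Fin n → Fin n) → Fin n → Fin n → ℕ
rev f i j = inv f i j + inv f j i

-- Unlike the length of a filtered list, a double sum can be transposed and reindexed along a
-- permutation.
inversions≡∑∑inv : (σ : Permutation′ n) → inversions σ ≡ ∑∑ (inv (σ ⟨$⟩ʳ_))
inversions≡∑∑inv σ = length-filter-cartesianProduct
  (λ (i , j) → (i Fin.<? j) ×-dec ((σ ⟨$⟩ʳ j) Fin.<? (σ ⟨$⟩ʳ i))) (λ i → i) (λ i → i)

∑∑-rev : (f : Fin n → Fin n) → ∑∑ (rev f) ≡ ∑∑ (inv f) + ∑∑ (inv f)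
∑∑-rev f = trans (∑∑-distrib-+ (inv f) (λ i j → inv f j i))
                 (cong (∑∑ (inv f) +_) (∑-comm (λ i j → inv f j i)))

rev-swap : (f : Fin n → Fin n) (i j : Fin n) → rev f i j ≡ rev f j i
rev-swap f i j = ℕ.+-comm (inv f i j) (inv f j i)

rev-refl : (f : Fin n → Fin n) (i : Fin n) → rev f i i ≡ 0
rev-refl f i rewrite lt-irrefl i = refl

double-injective : ∀ {a b} → a + a ≡ b + b → a ≡ b
double-injective {zero}  {zero}  eq = refl
double-injective {suc a} {suc b} eq = cong suc (double-injective (ℕ.suc-injective
  (trans (sym (ℕ.+-suc a a)) (trans (ℕ.suc-injective eq) (ℕ.+-suc b b)))))

-- Off the diagonal exactly one of `lt i j` and `lt j i` holds, so adding the transposed sum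
-- restores all of `h`. Doubling the left side avoids halving the right one.
∑∑-below : (h : Fin n → Fin n → ℕ) → (∀ i j → h i j ≡ h j i) → (∀ i → h i i ≡ 0) →
  ∑∑ (λ i j → bit (lt i j) * h i j) + ∑∑ (λ i j → bit (lt i j) * h i j) ≡ ∑∑ h
∑∑-below h h-sym h-refl = begin
  ∑∑ b + ∑∑ b                   ≡⟨ cong (∑∑ b +_) (∑-comm b) ⟩
  ∑∑ b + ∑∑ (λ i j → b j i)     ≡⟨ ∑∑-distrib-+ b (λ i j → b j i) ⟨
  ∑∑ (λ i j → b i j + b j i)    ≡⟨ ∑∑-cong step ⟩
  ∑∑ h                          ∎
  where
  b : Fin _ → Fin _ → ℕ
  b i j = bit (lt i j) * h i j
  step : ∀ i j → b i j + b j i ≡ h i j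
  step i j with lt i j | lt j i | compare i j
  ... | _ | _ | below _    = trans (ℕ.+-identityʳ _) (ℕ.*-identityˡ _)
  ... | _ | _ | equal refl = sym (h-refl i)
  ... | _ | _ | above _    = trans (ℕ.*-identityˡ _) (h-sym j i)

-- Half of ∑∑ (rev g) is summed over the pairs i < j as well as over the pairs
-- f i < f j, as rev g is symmetric.
∑∑-inv-∘ : (σ : Permutation′ n) (g : Fin n → Fin n) → let f = σ ⟨$⟩ʳ_ in
  ∑∑ (λ i j → bit (lt i j) * rev g (f i) (f j)) ≡ ∑∑ (inv g)
∑∑-inv-∘ σ g = double-injective (begin
  _ ≡⟨ ∑∑-below (λ i j → rev g (f i) (f j)) (λ i j → rev-swap g (f i) (f j)) (λ i → rev-refl g (f i)) ⟩
  ∑∑ (λ i j → rev g (f i) (f j)) ≡⟨ ∑∑-permute σ (rev g) ⟨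
  ∑∑ (rev g)                     ≡⟨ ∑∑-rev g ⟩
  _ ∎)
  where f = σ ⟨$⟩ʳ_

-- For `i < j`, the composite inverts the pair exactly when one, but not both, of `f` on `i`, `j`
-- and `g` on `f i`, `f j` reverses the order. If both do, the right side is 2. Summing over all
-- pairs makes the sign a homomorphism.
parity-inv-∘ : (σ τ : Permutation′ n) → let f = σ ⟨$⟩ʳ_ ; g = τ ⟨$⟩ʳ_ in ∀ i j →
  parity (inv (g ∘ f) i j) ≡ parity (inv f i j + bit (lt i j) * rev g (f i) (f j))
parity-inv-∘ σ τ i j with lt i j | lt j i | compare i j
... | _ | _ | equal _ = refl
... | _ | _ | above _ = refl
... | _ | _ | below i≢j with lt (f i) (f j) | lt (f j) (f i) | compare (f i) (f j)
    where f = σ ⟨$⟩ʳ_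
...   | _ | _ | equal fi≡fj = contradiction (injective σ fi≡fj) i≢j
...   | _ | _ | below fi≢fj with lt (τ ⟨$⟩ʳ (σ ⟨$⟩ʳ j)) (τ ⟨$⟩ʳ (σ ⟨$⟩ʳ i))
...     | true  = refl
...     | false = refl
parity-inv-∘ σ τ i j | _ | _ | below i≢j | _ | _ | above fi≢fj
  with lt (τ ⟨$⟩ʳ (σ ⟨$⟩ʳ i)) (τ ⟨$⟩ʳ (σ ⟨$⟩ʳ j)) | lt (τ ⟨$⟩ʳ (σ ⟨$⟩ʳ j)) (τ ⟨$⟩ʳ (σ ⟨$⟩ʳ i))
     | compare (τ ⟨$⟩ʳ (σ ⟨$⟩ʳ i)) (τ ⟨$⟩ʳ (σ ⟨$⟩ʳ j))
... | _ | _ | below _ = refl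
... | _ | _ | above _ = refl
... | _ | _ | equal eq = contradiction (injective τ eq) fi≢fj

π-cong : {σ τ : Permutation′ n} → σ ≈ τ → π σ ≡ π τ
π-cong {σ = σ} {τ} σ≈τ = cong parity (begin
  inversions σ           ≡⟨ inversions≡∑∑inv σ ⟩
  ∑∑ (inv (σ ⟨$⟩ʳ_))     ≡⟨ ∑∑-cong (λ i j → cong₂ (λ a b → bit (lt i j ∧ lt a b)) (σ≈τ j) (σ≈τ i)) ⟩
  ∑∑ (inv (τ ⟨$⟩ʳ_))     ≡⟨ inversions≡∑∑inv τ ⟨
  inversions τ           ∎)

π-∘ : (σ τ : Permutation′ n) → π (σ ∘ₚ τ) ≡ π σ ℙ.+ π τ
π-∘ σ τ = begin
  parity (inversions (σ ∘ₚ τ))  ≡⟨ cong parity (inversions≡∑∑inv (σ ∘ₚ τ)) ⟩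
  parity (∑∑ (inv (g ∘ f)))
    ≡⟨ parity-sum-cong (λ i → parity-sum-cong (parity-inv-∘ σ τ i)) ⟩
  parity (∑∑ (λ i j → inv f i j + bit (lt i j) * rev g (f i) (f j)))
    ≡⟨ cong parity (∑∑-distrib-+ (inv f) (λ i j → bit (lt i j) * rev g (f i) (f j))) ⟩
  parity (∑∑ (inv f) + ∑∑ (λ i j → bit (lt i j) * rev g (f i) (f j)))
    ≡⟨ cong (λ k → parity (∑∑ (inv f) + k)) (∑∑-inv-∘ σ g) ⟩
  parity (∑∑ (inv f) + ∑∑ (inv g))
    ≡⟨ ℙ.+-homo-+ (∑∑ (inv f)) _ ⟩
  parity (∑∑ (inv f)) ℙ.+ parity (∑∑ (inv g))
    ≡⟨ cong₂ (λ a b → parity a ℙ.+ parity b) (inversions≡∑∑inv σ) (inversions≡∑∑inv τ) ⟨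
  π σ ℙ.+ π τ ∎
  where
  f = σ ⟨$⟩ʳ_
  g = τ ⟨$⟩ʳ_

π-id : π (id {n}) ≡ 0ℙ
π-id {n} = ℙ.+-cancelˡ-≡ (π (id {n})) _ _ (begin
  π (id {n}) ℙ.+ π (id {n})  ≡⟨ π-∘ (id {n}) id ⟨
  π (id {n} ∘ₚ id)           ≡⟨ π-cong {σ = id {n} ∘ₚ id} {id} (λ _ → refl) ⟩
  π (id {n})                 ≡⟨ ℙ.+-identityʳ _ ⟨
  π (id {n}) ℙ.+ 0ℙ          ∎)

π-flip : (σ : Permutation′ n) → π (flip σ) ≡ π σ
π-flip {n} σ = ℙ.+-cancelˡ-≡ (π σ) _ _ (begin
  π σ ℙ.+ π (flip σ)  ≡⟨ π-∘ σ (flip σ) ⟨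
  π (σ ∘ₚ flip σ)     ≡⟨ π-cong {σ = σ ∘ₚ flip σ} {id} (λ _ → inverseˡ σ) ⟩
  π (id {n})          ≡⟨ π-id {n} ⟩
  0ℙ                  ≡⟨ ℙ.p+p≡0ℙ (π σ) ⟨
  π σ ℙ.+ π σ         ∎)

π-conjugate : (θ σ : Permutation′ n) → π (flip θ ∘ₚ σ ∘ₚ θ) ≡ π σ
π-conjugate θ σ = begin
  π (flip θ ∘ₚ σ ∘ₚ θ)          ≡⟨ π-∘ (flip θ) (σ ∘ₚ θ) ⟩
  π (flip θ) ℙ.+ π (σ ∘ₚ θ)     ≡⟨ cong₂ ℙ._+_ (π-flip θ) (trans (π-∘ σ θ) (ℙ.+-comm (π σ) (π θ))) ⟩
  π θ ℙ.+ (π θ ℙ.+ π σ)         ≡⟨ ℙ.+-assoc (π θ) (π θ) (π σ) ⟨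
  π θ ℙ.+ π θ ℙ.+ π σ           ≡⟨ cong (ℙ._+ π σ) (ℙ.p+p≡0ℙ (π θ)) ⟩
  π σ                           ∎

π-lift₀ : (σ : Permutation′ n) → π (lift₀ σ) ≡ π σ
π-lift₀ {n} σ = cong parity (begin
  inversions (lift₀ σ)           ≡⟨ inversions≡∑∑inv (lift₀ σ) ⟩
  -- The row of `zero` has no inversions because `lift₀ σ` fixes `zero`; the column of `zero`
  -- vanishes by computation.
  _                              ≡⟨ cong (_+ ∑∑ (inv (σ ⟨$⟩ʳ_))) (sum-zero {n} (λ _ → refl)) ⟩
  ∑∑ (inv (σ ⟨$⟩ʳ_))             ≡⟨ inversions≡∑∑inv σ ⟨
  inversions σ                   ∎)

inv-id : (i j : Fin n) → inv (λ k → k) i j ≡ 0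
inv-id i j with lt i j | lt j i | compare i j
... | _ | _ | below _ = refl
... | _ | _ | equal _ = refl
... | _ | _ | above _ = refl

π-swap : π (swap {n} id) ≡ 1ℙ
π-swap {n} = cong parity (trans (inversions≡∑∑inv (swap {n} id))
  -- The only inversion is the pair of the first two elements, which accounts for the `suc`. From
  -- the third row on, the summand is that of the identity.
  (cong₂ _+_ (cong suc (sum-zero {n} (λ _ → refl)))
             (cong₂ _+_ (sum-zero {n} (λ _ → refl))
                        (sum-zero (λ i → sum-zero {n} (λ j → inv-id i j))))))

-- The transposition is a conjugate of the swap of the first two elements: `θ` fixes `zero` and
-- carries `suc zero` to `suc k`.
π-transpose₀ : (k : Fin n) → π (transpose zero (suc k)) ≡ 1ℙ
π-transpose₀ {suc n} k = begin
  π (transpose zero (suc k))         ≡⟨ π-cong {σ = transpose zero (suc k)} {flip θ ∘ₚ swap id ∘ₚ θ} conj ⟩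
  π (flip θ ∘ₚ swap id ∘ₚ θ)         ≡⟨ π-conjugate θ (swap id) ⟩
  π (swap {n} id)                    ≡⟨ π-swap {n} ⟩
  1ℙ                                 ∎
  where
  θ : Permutation′ (suc (suc n))
  θ = lift₀ (transpose zero k)
  transposeˡ : PC.transpose k zero k ≡ zero
  transposeˡ rewrite dec-true (k Fin.≟ k) refl = refl
  conj : transpose zero (suc k) ≈ flip θ ∘ₚ swap id ∘ₚ θ
  conj zero    = refl
  conj (suc i) with PC.transpose k zero i in eq | PC.transpose-inverse zero k {i}
  ... | zero  | refl rewrite dec-true (k Fin.≟ k) refl = refl
  ... | suc y | back
    rewrite dec-false (i Fin.≟ k) (λ { refl → Fin.0≢1+n (trans (sym transposeˡ) eq) }) = cong suc (sym back)

-- First return permutations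

-- The first element of the image of ι among v, f v, f (f v), … is ι j.
data Reach (f : Fin m → Fin m) (ι : Fin n → Fin m) (v : Fin m) (j : Fin n) : Set where
  here : v ≡ ι j → Reach f ι v j
  step : (∀ i → ι i ≢ v) → Reach f ι (f v) j → Reach f ι v j

Reach-unique : {f : Fin m → Fin m} {ι : Fin n → Fin m} → Injective _≡_ _≡_ ι →
  ∀ {v i j} → Reach f ι v i → Reach f ι v j → i ≡ j
Reach-unique ι-inj (here p)   (here q)   = ι-inj (trans (sym p) q)
Reach-unique ι-inj (here p)   (step v∉ _) = contradiction (sym p) (v∉ _)
Reach-unique ι-inj (step v∉ _) (here q)   = contradiction (sym q) (v∉ _)
Reach-unique ι-inj (step _ r) (step _ s) = Reach-unique ι-inj r s

Reach-map : {f g : Fin m → Fin m} {ι κ : Fin n → Fin m} (h : Fin m → Fin m) → Injective _≡_ _≡_ h →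
  (∀ v → g (h v) ≡ h (f v)) → (∀ j → κ j ≡ h (ι j)) →
  ∀ {v j} → Reach f ι v j → Reach g κ (h v) j
Reach-map h h-inj comm ι↦κ (here v≡ιj) = here (trans (cong h v≡ιj) (sym (ι↦κ _)))
Reach-map {g = g} {κ = κ} h h-inj comm ι↦κ {v} {j} (step v∉ r) =
  step (λ i eq → v∉ i (h-inj (trans (sym (ι↦κ i)) eq)))
       (subst (λ u → Reach g κ u j) (sym (comm v)) (Reach-map h h-inj comm ι↦κ r))

Returning : Permutation′ m → (Fin n → Fin m) → Set
Returning Φ ι = ∀ v → ∃ λ j → Reach (Φ ⟨$⟩ʳ_) ι v j

-- The walk begins at the image of `ι i` under `Φ`, so a return takes at least one application of
-- `Φ`.
Return : Permutation′ m → (Fin n → Fin m) → Permutation′ n → Set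
Return Φ ι p = ∀ i → Reach (Φ ⟨$⟩ʳ_) ι (Φ ⟨$⟩ʳ ι i) (p ⟨$⟩ʳ i)

-- For injective `ι`, `parity (m + n)` is the parity of the number `m - n` of elements outside the
-- image of `ι`, each of which costs one transposition when it is cut out.
SignedReturn : Permutation′ m → (Fin n → Fin m) → Set
SignedReturn {m} {n} Φ ι =
  ∃ λ (p : Permutation′ n) → Return Φ ι p × π p ≡ π Φ ℙ.+ parity (m + n)

-- With nothing left to cut out, each return is a single application of `Φ`, and the return
-- permutation is `Φ` relabelled along the bijection `ι`.
signedReturn-surjective : (Φ : Permutation′ m) (ι : Fin n → Fin m) → Injective _≡_ _≡_ ι →
  (∀ v → ∃ λ j → ι j ≡ v) → SignedReturn Φ ι
signedReturn-surjective {m} {n} Φ ι ι-inj ι-surj = go (↔⇒≡ κ) κ (λ _ → refl)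
  where
  κ : Permutation n m
  κ = permutation ι (λ v → proj₁ (ι-surj v)) (λ v → proj₂ (ι-surj v)) (λ j → ι-inj (proj₂ (ι-surj (ι j))))
  -- `κ` is made a variable here, so that identifying `n` with `m` turns it into a permutation of
  -- one set, by which `Φ` can be conjugated.
  go : n ≡ m → (κ : Permutation n m) → (∀ i → κ ⟨$⟩ʳ i ≡ ι i) → SignedReturn Φ ι
  go refl κ κ≗ι = κ ∘ₚ Φ ∘ₚ flip κ
    , (λ i → here (trans (cong (Φ ⟨$⟩ʳ_) (sym (κ≗ι i))) (trans (sym (inverseʳ κ)) (κ≗ι _))))
    , (begin
      π (κ ∘ₚ Φ ∘ₚ flip κ)      ≡⟨ π-conjugate (flip κ) Φ ⟩
      π Φ                       ≡⟨ ℙ.+-identityʳ (π Φ) ⟨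
      π Φ ℙ.+ 0ℙ                ≡⟨ cong (π Φ ℙ.+_) (trans (ℙ.+-homo-+ m m) (ℙ.p+p≡0ℙ (parity m))) ⟨
      π Φ ℙ.+ parity (m + m)    ∎)

-- The vertex 0 is cut out of its cycle, by composing Φ with the transposition
-- of 0 and Φ 0; this does not change the return permutation.
signedReturn-bypass :
  (∀ (Φ : Permutation′ m) (ι : Fin n → Fin m) → Injective _≡_ _≡_ ι → Returning Φ ι → SignedReturn Φ ι) →
  (Φ : Permutation′ (suc m)) (ι : Fin n → Fin (suc m)) → Injective _≡_ _≡_ ι →
  (∀ j → ι j ≢ zero) → Returning Φ ι → SignedReturn Φ ι
signedReturn-bypass {m} {n} rec Φ ι ι-inj ι≢0 returning with Φ ⟨$⟩ʳ zero in Φ0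
-- If `Φ` fixed `zero`, the orbit of `zero` would never meet the image of `ι`.
... | zero  = contradiction (proj₂ (returning zero)) (λ r → stuck r refl)
  where
  stuck : ∀ {v j} → Reach (Φ ⟨$⟩ʳ_) ι v j → v ≢ zero
  stuck (here v≡ιj) refl = ι≢0 _ (sym v≡ιj)
  stuck (step _ r)  refl = stuck r Φ0
... | suc k = p , return , sign
  where
  -- The transposition is chosen so that `Φ₁` fixes `zero`, which can then be removed.
  Φ₁ : Permutation′ (suc m)
  Φ₁ = Φ ∘ₚ transpose zero (suc k)
  transposeʳ : PC.transpose zero (suc k) (suc k) ≡ zero
  transposeʳ rewrite dec-true (k Fin.≟ k) refl = refl
  Φ₁0≡0 : Φ₁ ⟨$⟩ʳ zero ≡ zero
  Φ₁0≡0 = trans (cong (PC.transpose zero (suc k)) Φ0) transposeʳ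
  Φ₂ : Permutation′ m
  Φ₂ = remove zero Φ₁
  ι₂ : Fin n → Fin m
  ι₂ j = punchOut {i = zero} {ι j} (ι≢0 j ∘ sym)
  suc-ι₂ : ∀ j → suc (ι₂ j) ≡ ι j
  suc-ι₂ j = Fin.punchIn-punchOut (ι≢0 j ∘ sym)
  suc-Φ₂ : ∀ v → suc (Φ₂ ⟨$⟩ʳ v) ≡ PC.transpose zero (suc k) (Φ ⟨$⟩ʳ suc v)
  suc-Φ₂ v = lift₀-remove Φ₁ Φ₁0≡0 (suc v)
  -- A step of `Φ₂` is a step of `Φ`, or two steps of `Φ` when the first one leads to `zero`. The
  -- value `suc k` is excluded because `Φ` takes it at `zero` already.
  bypass : ∀ v → (Φ ⟨$⟩ʳ suc v ≡ zero × suc (Φ₂ ⟨$⟩ʳ v) ≡ Φ ⟨$⟩ʳ zero) ⊎ Φ ⟨$⟩ʳ suc v ≡ suc (Φ₂ ⟨$⟩ʳ v)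
  bypass v = transposed (λ eq → Fin.0≢1+n (injective Φ (trans Φ0 (sym eq)))) (suc-Φ₂ v)
    where
    transposed : ∀ {u w} → u ≢ suc k → w ≡ PC.transpose zero (suc k) u →
      (u ≡ zero × w ≡ Φ ⟨$⟩ʳ zero) ⊎ u ≡ w
    transposed {zero}  u≢ eq = inj₁ (refl , trans eq (sym Φ0))
    transposed {suc u} u≢ eq rewrite dec-false (u Fin.≟ k) (u≢ ∘ cong suc) = inj₂ (sym eq)
  -- Invariant: the walk of `Φ` is at the same point as that of `Φ₂`, or it is at `zero` while the
  -- walk of `Φ₂` is already one step ahead.
  down : ∀ {u j} → Reach (Φ ⟨$⟩ʳ_) ι u j →
    ∀ v → u ≡ suc v ⊎ (u ≡ zero × suc v ≡ Φ ⟨$⟩ʳ zero) → Reach (Φ₂ ⟨$⟩ʳ_) ι₂ v j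
  down (here u≡ιj) v (inj₁ refl) = here (Fin.suc-injective (trans u≡ιj (sym (suc-ι₂ _))))
  down (here u≡ιj) v (inj₂ (refl , _)) = contradiction (sym u≡ιj) (ι≢0 _)
  down (step u∉ r) v (inj₁ refl) = step
    (λ i eq → u∉ i (trans (sym (suc-ι₂ i)) (cong suc eq)))
    (down r (Φ₂ ⟨$⟩ʳ v) (Sum⊎.swap (bypass v)))
  down (step u∉ r) v (inj₂ (refl , eq)) = down r v (inj₁ (sym eq))
  after : ∀ v {j} → Reach (Φ ⟨$⟩ʳ_) ι (suc (Φ₂ ⟨$⟩ʳ v)) j → Reach (Φ ⟨$⟩ʳ_) ι (Φ ⟨$⟩ʳ suc v) j
  after v {j} r with bypass v
  ... | inj₂ eq = subst (λ u → Reach (Φ ⟨$⟩ʳ_) ι u j) (sym eq) r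
  ... | inj₁ (Φv , eq) = subst (λ u → Reach (Φ ⟨$⟩ʳ_) ι u j) (sym Φv) (step ι≢0 (subst (λ u → Reach (Φ ⟨$⟩ʳ_) ι u j) eq r))
  up : ∀ {v j} → Reach (Φ₂ ⟨$⟩ʳ_) ι₂ v j → Reach (Φ ⟨$⟩ʳ_) ι (suc v) j
  up (here v≡ιj) = here (trans (cong suc v≡ιj) (suc-ι₂ _))
  up (step v∉ r) = step (λ i eq → v∉ i (Fin.suc-injective (trans (suc-ι₂ i) eq))) (after _ (up r))
  result : SignedReturn Φ₂ ι₂
  result = rec Φ₂ ι₂
    (λ {i} {j} eq → ι-inj (trans (sym (suc-ι₂ i)) (trans (cong suc eq) (suc-ι₂ j))))
    (λ v → let j , r = returning (suc v) in j , down r v (inj₁ refl))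
  p = proj₁ result
  return : Return Φ ι p
  return i = subst (λ u → Reach (Φ ⟨$⟩ʳ_) ι (Φ ⟨$⟩ʳ u) (p ⟨$⟩ʳ i)) (suc-ι₂ i) (after (ι₂ i) (up (proj₁ (proj₂ result) i)))
  sign : π p ≡ π Φ ℙ.+ parity (suc m + n)
  sign = begin
    π p                                     ≡⟨ proj₂ (proj₂ result) ⟩
    π Φ₂ ℙ.+ parity (m + n)                 ≡⟨ cong (ℙ._+ parity (m + n)) (π-lift₀ Φ₂) ⟨
    π (lift₀ Φ₂) ℙ.+ parity (m + n)
      ≡⟨ cong (ℙ._+ parity (m + n)) (π-cong {σ = lift₀ Φ₂} {Φ₁} (lift₀-remove Φ₁ Φ₁0≡0)) ⟩
    π Φ₁ ℙ.+ parity (m + n)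
      ≡⟨ cong (ℙ._+ parity (m + n)) (trans (π-∘ Φ (transpose zero (suc k))) (cong (π Φ ℙ.+_) (π-transpose₀ k))) ⟩
    π Φ ℙ.+ 1ℙ ℙ.+ parity (m + n)           ≡⟨ ℙ.+-assoc (π Φ) 1ℙ (parity (m + n)) ⟩
    π Φ ℙ.+ (1ℙ ℙ.+ parity (m + n))         ≡⟨ cong (π Φ ℙ.+_) (ℙ.+-homo-+ 1 (m + n)) ⟨
    π Φ ℙ.+ parity (suc m + n)              ∎

-- Induction on `m`. A point `w` outside the image of `ι` is moved to `zero` by conjugation, which
-- preserves the sign, and is then cut out. If there is no such point, `ι` is a bijection.
signedReturn : (Φ : Permutation′ m) (ι : Fin n → Fin m) → Injective _≡_ _≡_ ι →
  Returning Φ ι → SignedReturn Φ ι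
signedReturn {m} {n} Φ ι ι-inj returning
  with Fin.any? (λ w → Fin.all? (λ j → ¬? (ι j Fin.≟ w)))
signedReturn {m} {n} Φ ι ι-inj returning | no ¬∃ = signedReturn-surjective Φ ι ι-inj surj
  where
  surj : ∀ v → ∃ λ j → ι j ≡ v
  surj v with Fin.any? (λ j → ι j Fin.≟ v)
  ... | yes ∃j = ∃j
  ... | no ∄j = contradiction (v , λ j eq → ∄j (j , eq)) ¬∃
signedReturn {suc m} {n} Φ ι ι-inj returning | yes (w , w∉) =
  p , (λ i → subst (λ u → Reach (Φ ⟨$⟩ʳ_) ι u (p ⟨$⟩ʳ i))
                   (trans (inverseˡ θ) (cong (Φ ⟨$⟩ʳ_) (inverseˡ θ)))
        (Reach-map (θ ⟨$⟩ˡ_) (injective (flip θ)) (λ v → sym (inverseˡ θ)) (λ j → sym (inverseˡ θ)) (return i)))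
    , trans sign (cong (ℙ._+ parity (suc m + n)) (π-conjugate θ Φ))
  where
  θ : Permutation′ (suc m)
  θ = transpose w zero
  θw≡0 : θ ⟨$⟩ʳ w ≡ zero
  θw≡0 rewrite dec-true (w Fin.≟ w) refl = refl
  Φ′ = flip θ ∘ₚ Φ ∘ₚ θ
  result : SignedReturn Φ′ (λ j → θ ⟨$⟩ʳ ι j)
  result = signedReturn-bypass signedReturn Φ′ (λ j → θ ⟨$⟩ʳ ι j) (λ eq → ι-inj (injective θ eq))
    (λ j eq → w∉ j (injective θ (trans eq (sym θw≡0))))
    (λ v → let j , r = returning (θ ⟨$⟩ˡ v) in j , subst (λ u → Reach (Φ′ ⟨$⟩ʳ_) _ u j) (inverseʳ θ)
      (Reach-map (θ ⟨$⟩ʳ_) (injective θ) (λ v → cong (λ u → θ ⟨$⟩ʳ (Φ ⟨$⟩ʳ u)) (inverseˡ θ)) (λ _ → refl) r))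
  p = proj₁ result
  return = proj₁ (proj₂ result)
  sign = proj₂ (proj₂ result)

-- Permutations with odd periods

power : Permutation′ n → ℕ → Permutation′ n
power σ zero    = id
power σ (suc k) = power σ k ∘ₚ σ

power-fold : (σ : Permutation′ n) (k : ℕ) (v : Fin n) → power σ k ⟨$⟩ʳ v ≡ fold v (σ ⟨$⟩ʳ_) k
power-fold σ zero    v = refl
power-fold σ (suc k) v = cong (σ ⟨$⟩ʳ_) (power-fold σ k v)

π-power : (σ : Permutation′ n) (k : ℕ) → π (power σ k) ≡ parity k ℙ.* π σ
π-power {n} σ zero    = π-id {n}
π-power σ (suc k) = begin
  π (power σ k ∘ₚ σ)             ≡⟨ π-∘ (power σ k) σ ⟩
  π (power σ k) ℙ.+ π σ          ≡⟨ cong (ℙ._+ π σ) (π-power σ k) ⟩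
  parity k ℙ.* π σ ℙ.+ π σ       ≡⟨ ℙ.+-comm (parity k ℙ.* π σ) (π σ) ⟩
  π σ ℙ.+ (parity k ℙ.* π σ)     ≡⟨ ℙ.*-distribʳ-+ (π σ) 1ℙ (parity k) ⟨
  (1ℙ ℙ.+ parity k) ℙ.* π σ      ≡⟨ cong (ℙ._* π σ) (ℙ.+-homo-+ 1 k) ⟨
  parity (suc k) ℙ.* π σ         ∎

fold-period : ∀ {A : Set} {f : A → A} {a : A} {r : ℕ} k → fold a f r ≡ a → fold a f (k * r) ≡ a
fold-period zero eq = refl
fold-period {f = f} {a} {r} (suc k) eq = begin
  fold a f (r + k * r)         ≡⟨ fold-+ a f r ⟩
  fold (fold a f (k * r)) f r  ≡⟨ cong (λ b → fold b f r) (fold-period {f = f} {r = r} k eq) ⟩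
  fold a f r                   ≡⟨ eq ⟩
  a                            ∎

OddPeriod : ∀ {A : Set} → (A → A) → A → Set
OddPeriod f a = ∃ λ r → parity r ≡ 1ℙ × fold a f r ≡ a

common-period : ∀ {A : Set} {f : A → A} (h : Fin n → A) → (∀ i → OddPeriod f (h i)) →
  ∃ λ r → parity r ≡ 1ℙ × ∀ i → fold (h i) f r ≡ h i
common-period {zero}          h odd = 1 , refl , λ ()
common-period {suc n} {f = f} h odd =
  let r , r-odd , r-period = odd zero
      s , s-odd , s-period = common-period (h ∘ suc) (odd ∘ suc)
  in r * s
   , trans (ℙ.*-homo-* r s) (cong₂ ℙ._*_ r-odd s-odd)
   , λ { zero    → trans (cong (fold (h zero) f) (ℕ.*-comm r s)) (fold-period s r-period)
       ; (suc i) → fold-period r (s-period i) }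

-- The product `r` of odd periods of all points is odd and makes the `r`-th power of `σ` the
-- identity; but an odd power has the sign of `σ`.
oddPeriods⇒even : (σ : Permutation′ n) → (∀ v → OddPeriod (σ ⟨$⟩ʳ_) v) → π σ ≡ 0ℙ
oddPeriods⇒even {n} σ odd =
  let r , r-odd , period = common-period (λ v → v) odd in begin
  π σ                   ≡⟨ cong (ℙ._* π σ) r-odd ⟨
  parity r ℙ.* π σ      ≡⟨ π-power σ r ⟨
  π (power σ r)         ≡⟨ π-cong {σ = power σ r} {id} (λ v → trans (power-fold σ r v) (period v)) ⟩
  π (id {n})            ≡⟨ π-id {n} ⟩
  0ℙ                    ∎

-- Orbits and cycles

next-inject₁ : (i : Fin n) → next (inject₁ i) ≡ suc i
next-inject₁ {n} i = Fin.toℕ-injective (begin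
  toℕ (next (inject₁ i))              ≡⟨ Fin.toℕ-fromℕ< _ ⟩
  suc (toℕ (inject₁ i)) ℕ.% suc n     ≡⟨ cong (λ k → suc k ℕ.% suc n) (Fin.toℕ-inject₁ i) ⟩
  suc (toℕ i) ℕ.% suc n               ≡⟨ ℕ.m<n⇒m%n≡m (s<s (Fin.toℕ<n i)) ⟩
  suc (toℕ i)                         ∎)

next-fromℕ : (n : ℕ) → next (fromℕ n) ≡ zero
next-fromℕ n = Fin.toℕ-injective (begin
  toℕ (next (fromℕ n))                ≡⟨ Fin.toℕ-fromℕ< _ ⟩
  suc (toℕ (fromℕ n)) ℕ.% suc n       ≡⟨ cong (λ k → suc k ℕ.% suc n) (Fin.toℕ-fromℕ n) ⟩
  suc n ℕ.% suc n                     ≡⟨ ℕ.n%n≡0 (suc n) ⟩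
  0                                   ∎)

next-surjective : (i : Fin (suc n)) → ∃ λ j → next j ≡ i
next-surjective zero    = fromℕ _ , next-fromℕ _
next-surjective (suc i) = inject₁ i , next-inject₁ i

next-injective : {i j : Fin (suc n)} → next i ≡ next j → i ≡ j
next-injective {i = i} {j} eq with view i | view j
... | ‵fromℕ     | ‵fromℕ     = refl
... | ‵fromℕ     | ‵inject₁ j =
  contradiction (trans (sym (next-fromℕ _)) (trans eq (next-inject₁ j))) Fin.0≢1+n
... | ‵inject₁ i | ‵fromℕ     =
  contradiction (trans (sym (next-fromℕ _)) (trans (sym eq) (next-inject₁ i))) Fin.0≢1+n
... | ‵inject₁ i | ‵inject₁ j =
  cong inject₁ (Fin.suc-injective (trans (sym (next-inject₁ i)) (trans eq (next-inject₁ j))))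

-- From `i` one climbs to `fromℕ n`, wraps round to `zero`, and climbs from there to any `j`.
next-closed⇒all : (P : Pred (Fin (suc n)) 0ℓ) → (∀ i → P i → P (next i)) →
  ∀ {i} → P i → ∀ j → P j
next-closed⇒all {n} P closed {i} Pi = Fin.<-weakInduction P
  (subst P (next-fromℕ n) (closed _ (last i Pi)))
  (λ j Pj → subst P (next-inject₁ j) (closed _ Pj))
  where
  last : ∀ i → P i → P (fromℕ n)
  last = Fin.>-weakInduction (λ i → P i → P (fromℕ n)) (λ p → p)
    (λ j rec Pj → rec (subst P (next-inject₁ j) (closed _ Pj)))

record Orbit {A : Set} (g : A → A) (e : A) : Set where
  field
    length-1 : ℕ
    period   : fold e g (suc length-1) ≡ e
  at : Fin (suc length-1) → A
  at i = fold e g (toℕ i)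
  field
    at-injective : ∀ {i j} → at i ≡ at j → i ≡ j

  at-next : ∀ i → at (next i) ≡ g (at i)
  at-next i with view i
  ... | ‵fromℕ = begin
    fold e g (toℕ (next (fromℕ length-1)))  ≡⟨ cong at (next-fromℕ length-1) ⟩
    e                                       ≡⟨ period ⟨
    g (fold e g length-1)                   ≡⟨ cong (λ k → g (fold e g k)) (Fin.toℕ-fromℕ length-1) ⟨
    g (fold e g (toℕ (fromℕ length-1)))     ∎
  ... | ‵inject₁ j = begin
    fold e g (toℕ (next (inject₁ j)))       ≡⟨ cong at (next-inject₁ j) ⟩
    g (fold e g (toℕ j))                    ≡⟨ cong (λ k → g (fold e g k)) (Fin.toℕ-inject₁ j) ⟨
    g (fold e g (toℕ (inject₁ j)))          ∎

  at-covers : ∀ k → ∃ λ i → at i ≡ fold e g k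
  at-covers zero    = zero , refl
  at-covers (suc k) = let i , eq = at-covers k in next i , trans (at-next i) (cong g eq)

least : {P : Pred ℕ 0ℓ} → Decidable P → ∀ k →
  (∀ i → i < k → ¬ P i) ⊎ ∃ λ l → P l × (∀ i → i < l → ¬ P i)
least P? zero = inj₁ (λ _ ())
least {P} P? (suc k) with least P? k
... | inj₂ found = inj₂ found
... | inj₁ none with P? k
...   | yes Pk = inj₂ (k , Pk , none)
...   | no ¬Pk = inj₁ none′
  where
  none′ : ∀ i → i < suc k → ¬ P i
  none′ i i<1+k with ℕ.m<1+n⇒m<n∨m≡n i<1+k
  ... | inj₁ i<k  = none i i<k
  ... | inj₂ refl = ¬Pk

module _ {A : Set} (code : A → Fin n) (code-injective : Injective _≡_ _≡_ code)
  {g : A → A} (P : Pred A 0ℓ) (P-closed : ∀ {a} → P a → P (g a))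
  (g-injective : ∀ {a b} → P a → P b → g a ≡ g b → a ≡ b) where

  opaque
    -- Among sufficiently many iterates two coincide, and cancelling the injective `g` turns the
    -- coincidence into a return to `e`. Before the least return all iterates are distinct.
    -- Injectivity is asked only on `P` because the successor map on the arcs of a splice is
    -- injective only on chosen arcs.
    orbit : ∀ {e} → P e → Orbit g e
    orbit {e} Pe = fromFirst first
      where
      P-fold : ∀ k → P (fold e g k)
      P-fold zero    = Pe
      P-fold (suc k) = P-closed (P-fold k)

      cancel : ∀ i k → fold e g i ≡ fold e g (i + k) → fold e g k ≡ e
      cancel zero    k eq = sym eq
      cancel (suc i) k eq = cancel i k (g-injective (P-fold i) (P-fold (i + k)) eq)

      cancel-< : ∀ {i j} → i < j → fold e g i ≡ fold e g j → ∃ λ d → suc d ≤ j × fold e g (suc d) ≡ e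
      cancel-< {i} i<j eq with d , refl ← ℕ.m≤n⇒∃[o]m+o≡n i<j = d , s≤s (ℕ.m≤n+m d i)
        , cancel i (suc d) (trans eq (cong (fold e g) (sym (ℕ.+-suc i d))))

      returns : ∃ λ d → fold e g (suc d) ≡ e
      returns with i , j , i<j , eq ← Fin.pigeonhole (ℕ.n<1+n n) (λ i → code (fold e g (toℕ i))) =
        let d , _ , p = cancel-< i<j (code-injective eq) in d , p

      returns? : Decidable (λ d → fold e g (suc d) ≡ e)
      returns? d with code (fold e g (suc d)) Fin.≟ code e
      ... | yes eq = yes (code-injective eq)
      ... | no ¬eq = no (¬eq ∘ cong code)

      first : ∃ λ l → fold e g (suc l) ≡ e × (∀ i → i < l → fold e g (suc i) ≢ e)
      first with least returns? (suc (proj₁ returns))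
      ... | inj₁ none  = contradiction (proj₂ returns) (none _ (ℕ.n<1+n _))
      ... | inj₂ found = found

      fromFirst : (∃ λ l → fold e g (suc l) ≡ e × (∀ i → i < l → fold e g (suc i) ≢ e)) → Orbit g e
      fromFirst (l , period , minimal) =
        record { length-1 = l ; period = period ; at-injective = λ {i j} → distinct i j }
        where
        distinct-< : ∀ (i j : Fin (suc l)) → toℕ i < toℕ j → fold e g (toℕ i) ≢ fold e g (toℕ j)
        distinct-< i j i<j eq with d , d<j , p ← cancel-< i<j eq =
          minimal d (ℕ.<-≤-trans d<j (ℕ.≤-pred (Fin.toℕ<n j))) p

        distinct : ∀ (i j : Fin (suc l)) → fold e g (toℕ i) ≡ fold e g (toℕ j) → i ≡ j
        distinct i j eq with ℕ.<-cmp (toℕ i) (toℕ j)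
        ... | tri< i<j _ _ = contradiction eq (distinct-< i j i<j)
        ... | tri≈ _ i≡j _ = Fin.toℕ-injective i≡j
        ... | tri> _ _ i>j = contradiction (sym eq) (distinct-< j i i>j)

module _ {A : Set} (g : A → A) where

  -- Meeting of forward orbits: an equivalence relation for every `g`, definable without an inverse.
  -- On periodic points it means lying on the same cycle.
  Joinable : A → A → Set
  Joinable a b = ∃₂ λ k l → fold a g k ≡ fold b g l

  joinable-refl : ∀ {a b} → a ≡ b → Joinable a b
  joinable-refl refl = 0 , 0 , refl

  joinable-sym : ∀ {a b} → Joinable a b → Joinable b a
  joinable-sym (k , l , eq) = l , k , sym eq

  joinable-trans : ∀ {a b c} → Joinable a b → Joinable b c → Joinable a c
  joinable-trans {a} {b} {c} (k , l , eq) (k′ , l′ , eq′) = k′ + k , l + l′ , (begin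
    fold a g (k′ + k)          ≡⟨ fold-+ a g k′ ⟩
    fold (fold a g k) g k′     ≡⟨ cong (λ z → fold z g k′) eq ⟩
    fold (fold b g l) g k′     ≡⟨ fold-+ b g k′ ⟨
    fold b g (k′ + l)          ≡⟨ cong (fold b g) (ℕ.+-comm k′ l) ⟩
    fold b g (l + k′)          ≡⟨ fold-+ b g l ⟩
    fold (fold b g k′) g l     ≡⟨ cong (λ z → fold z g l) eq′ ⟩
    fold (fold c g l′) g l     ≡⟨ fold-+ c g l ⟨
    fold c g (l + l′)          ∎)

  joinable-isEquivalence : IsEquivalence Joinable
  joinable-isEquivalence = record
    { refl = joinable-refl refl ; sym = joinable-sym ; trans = joinable-trans }

  -- From the meeting point, which is `l` steps after `b`, another `l * r` steps complete `l` full
  -- rounds of the orbit of `b` and so end at `b`.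
  joinable⇒at : ∀ {a b} (O : Orbit g a) → Orbit g b → Joinable a b → ∃ λ i → Orbit.at O i ≡ b
  joinable⇒at {a} {b} O O′ (k , l , eq) = let i , at-i = Orbit.at-covers O (l * r + k) in i , (begin
    Orbit.at O i                 ≡⟨ at-i ⟩
    fold a g (l * r + k)         ≡⟨ fold-+ a g (l * r) ⟩
    fold (fold a g k) g (l * r)  ≡⟨ cong (λ z → fold z g (l * r)) eq ⟩
    fold (fold b g l) g (l * r)  ≡⟨ fold-+ b g (l * r) ⟨
    fold b g (l * r + l)         ≡⟨ cong (fold b g) (trans (ℕ.+-comm (l * r) l) (sym (ℕ.*-suc l r))) ⟩
    fold b g (l * suc r)         ≡⟨ fold-period l (Orbit.period O′) ⟩
    b                            ∎)
    where r = Orbit.length-1 O′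

permutation-orbit : (σ : Permutation′ n) → ∀ v → Orbit (σ ⟨$⟩ʳ_) v
permutation-orbit σ v = orbit (λ v → v) (λ eq → eq) (λ v → v ≡ v) (λ _ → refl) (λ _ _ → injective σ) refl

-- The orbit of `zero` lists every element once, and this list serves as the permutation `c` of
-- `FullCycle`.
transitive⇒fullCycle : (σ : Permutation′ (suc n)) → (∀ i j → Joinable (σ ⟨$⟩ʳ_) i j) → FullCycle σ
transitive⇒fullCycle {n} σ transitive = go σ (↔⇒≡ κ) κ (λ i → sym (Orbit.at-next (orb zero) i))
  where
  orb : ∀ i → Orbit (σ ⟨$⟩ʳ_) i
  orb = permutation-orbit σ
  covers : ∀ i → ∃ λ k → Orbit.at (orb zero) k ≡ i
  covers i = joinable⇒at (σ ⟨$⟩ʳ_) (orb zero) (orb i) (transitive zero i)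
  κ : Permutation (suc (Orbit.length-1 (orb zero))) (suc n)
  κ = permutation (Orbit.at (orb zero)) (proj₁ ∘ covers) (proj₂ ∘ covers)
    (λ k → Orbit.at-injective (orb zero) (proj₂ (covers (Orbit.at (orb zero) k))))
  -- Both sizes are variables here, so that the length of the orbit can be identified with the
  -- number of elements.
  go : ∀ {l n} (σ : Permutation′ n) → l ≡ n → (κ : Permutation l n) →
    (∀ i → σ ⟨$⟩ʳ (κ ⟨$⟩ʳ i) ≡ κ ⟨$⟩ʳ next i) → FullCycle σ
  go σ refl κ cycle = κ , cycle

fullCycle-conjugate : (θ σ τ : Permutation′ n) → (∀ i → τ ⟨$⟩ʳ (θ ⟨$⟩ʳ i) ≡ θ ⟨$⟩ʳ (σ ⟨$⟩ʳ i)) →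
  FullCycle σ → FullCycle τ
fullCycle-conjugate θ σ τ θσ≡τθ (c , cycle) =
  c ∘ₚ θ , λ i → trans (θσ≡τθ (c ⟨$⟩ʳ i)) (cong (θ ⟨$⟩ʳ_) (cycle i))

-- Alternating cycles and factors

opaque
  other : ∀ {A : Set} {P : Pred A 0ℓ} → Enumeration (setoid A) P 2 → ∀ {a} → P a →
    ∃ λ b → b ≢ a × P b × (∀ {c} → P c → c ≡ a ⊎ c ≡ b)
  other {A} {P} E {a} Pa = by-index (E.complete Pa)
    where
    module E = Enumeration E
    cases : ∀ {c} → P c → c ≡ E.at zero ⊎ c ≡ E.at (suc zero)
    cases Pc with E.complete Pc
    ... | zero     , eq = inj₁ (sym eq)
    ... | suc zero , eq = inj₂ (sym eq)
    by-index : (∃ λ i → E.at i ≡ a) → ∃ λ b → b ≢ a × P b × (∀ {c} → P c → c ≡ a ⊎ c ≡ b)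
    by-index (zero     , refl) =
      E.at (suc zero) , (λ eq → Fin.0≢1+n (sym (E.injective eq))) , E.sound (suc zero) , cases
    by-index (suc zero , refl) =
      E.at zero , (λ eq → Fin.0≢1+n (E.injective eq)) , E.sound zero , λ Pc → Sum⊎.swap (cases Pc)

fold-suc : ∀ {A : Set} (a : A) (f : A → A) k → fold a f (suc k) ≡ fold (f a) f k
fold-suc a f k = trans (cong (fold a f) (ℕ.+-comm 1 k)) (fold-+ a f k)

module Alternation (F : TwoDigraph n) where
  open TwoDigraph F
  module Exits   = Enumeration exits
  module Entries = Enumeration entries

  Arc : Set
  Arc = Fin ∣A∣

  start≢exit : ∀ e i → start e ≢ exit i
  start≢exit e i eq =
    contradiction (proj₁ (Enumeration.complete (proj₂ (Exits.sound i)) {e} eq)) Fin.¬Fin0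

  end≢entry : ∀ e i → end e ≢ entry i
  end≢entry e i eq =
    contradiction (proj₁ (Enumeration.complete (proj₁ (Entries.sound i)) {e} eq)) Fin.¬Fin0

  entry≢exit : ∀ i j → entry i ≢ exit j
  entry≢exit i j eq = end≢entry (at zero) i (trans (sound zero) (sym eq))
    where open Enumeration (proj₁ (Exits.sound j))

  inDegree-end : ∀ e → InDegree digraph (end e) 2
  inDegree-end e with degrees (end e)
  ... | inj₁ (in-0 , _)        = contradiction (proj₁ (Enumeration.complete in-0 {e} refl)) Fin.¬Fin0
  ... | inj₂ (inj₁ (in-2 , _)) = in-2
  ... | inj₂ (inj₂ (in-2 , _)) = in-2

  outDegree-start : ∀ e → OutDegree digraph (start e) 2
  outDegree-start e with degrees (start e)
  ... | inj₁ (_ , out-2)        = out-2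
  ... | inj₂ (inj₁ (_ , out-0)) = contradiction (proj₁ (Enumeration.complete out-0 {e} refl)) Fin.¬Fin0
  ... | inj₂ (inj₂ (_ , out-2)) = out-2

  -- α e is the other arc with the same end as e, β e the other arc with the
  -- same start.
  opaque
    α β : Arc → Arc
    α e = proj₁ (other (inDegree-end e) refl)
    β e = proj₁ (other (outDegree-start e) refl)

    α≢ : ∀ e → α e ≢ e
    α≢ e = proj₁ (proj₂ (other (inDegree-end e) refl))

    β≢ : ∀ e → β e ≢ e
    β≢ e = proj₁ (proj₂ (other (outDegree-start e) refl))

    end-α : ∀ e → end (α e) ≡ end e
    end-α e = proj₁ (proj₂ (proj₂ (other (inDegree-end e) refl)))

    start-β : ∀ e → start (β e) ≡ start e
    start-β e = proj₁ (proj₂ (proj₂ (other (outDegree-start e) refl)))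

    sameEnd : ∀ {e e′} → end e′ ≡ end e → e′ ≡ e ⊎ e′ ≡ α e
    sameEnd {e} = proj₂ (proj₂ (proj₂ (other (inDegree-end e) refl)))

    sameStart : ∀ {e e′} → start e′ ≡ start e → e′ ≡ e ⊎ e′ ≡ β e
    sameStart {e} = proj₂ (proj₂ (proj₂ (other (outDegree-start e) refl)))

  α-involutive : ∀ e → α (α e) ≡ e
  α-involutive e with sameEnd (sym (end-α e))
  ... | inj₁ e≡αe  = contradiction (sym e≡αe) (α≢ e)
  ... | inj₂ e≡ααe = sym e≡ααe

  β-involutive : ∀ e → β (β e) ≡ e
  β-involutive e with sameStart (sym (start-β e))
  ... | inj₁ e≡βe  = contradiction (sym e≡βe) (β≢ e)
  ... | inj₂ e≡ββe = sym e≡ββe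

  βα : Arc → Arc
  βα e = β (α e)

  βα-injective : ∀ {e e′} → βα e ≡ βα e′ → e ≡ e′
  βα-injective {e} {e′} eq = begin
    e                   ≡⟨ α-involutive e ⟨
    α (α e)             ≡⟨ cong α (β-involutive (α e)) ⟨
    α (β (βα e))        ≡⟨ cong (λ a → α (β a)) eq ⟩
    α (β (βα e′))       ≡⟨ cong α (β-involutive (α e′)) ⟩
    α (α e′)            ≡⟨ α-involutive e′ ⟩
    e′                  ∎

  -- An equality (βα)ᵏ e = α e can be shortened by conjugation with βα, down to
  -- a fixed point of α or of β.
  βα-power≢α : ∀ k e → fold e βα k ≢ α e
  βα-power≢α zero          e eq = α≢ e (sym eq)
  βα-power≢α (suc zero)    e eq = β≢ (α e) eq
  βα-power≢α (suc (suc k)) e eq = βα-power≢α k (βα e) (βα-injective (begin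
    βα (fold (βα e) βα k)        ≡⟨ cong βα (fold-suc e βα k) ⟨
    fold e βα (suc (suc k))      ≡⟨ eq ⟩
    α e                          ≡⟨ β-involutive (α e) ⟨
    β (βα e)                     ≡⟨ cong β (α-involutive (βα e)) ⟨
    βα (α (βα e))                ∎))

  opaque
    orbit-βα : ∀ e → Orbit βα e
    orbit-βα e = orbit (λ e → e) (λ eq → eq) (λ e → e ≡ e) (λ _ → refl) (λ _ _ → βα-injective) refl

  -- The forward arcs are the `βα`-orbit of `e` and the backward arcs their images under `α`. That
  -- no arc is both is `βα-power≢α`.
  alternatingCycle : Arc → AlternatingCycle digraph
  alternatingCycle e = record
    { r                  = suc length-1
    ; r>0                = s≤s z≤n
    ; forward            = at
    ; backward           = α ∘ at
    ; forward-injective  = at-injective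
    ; backward-injective = λ eq → at-injective
        (trans (sym (α-involutive _)) (trans (cong α eq) (α-involutive _)))
    ; forward≢backward   = disjoint
    ; common-end         = λ i → sym (end-α (at i))
    ; common-start       = λ i → trans (sym (start-β (α (at i)))) (cong start (sym (at-next i)))
    }
    where
    open Orbit (orbit-βα e)
    disjoint-≤ : ∀ {k l} → k ≤ l → fold e βα l ≢ α (fold e βα k)
    disjoint-≤ {k} k≤l eq with d , refl ← ℕ.m≤n⇒∃[o]m+o≡n k≤l =
      βα-power≢α d (fold e βα k) (begin
        fold (fold e βα k) βα d    ≡⟨ fold-+ e βα d ⟨
        fold e βα (d + k)          ≡⟨ cong (fold e βα) (ℕ.+-comm d k) ⟩
        fold e βα (k + d)          ≡⟨ eq ⟩
        α (fold e βα k)            ∎)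
    disjoint : ∀ i j → at i ≢ α (at j)
    disjoint i j eq with ℕ.≤-total (toℕ j) (toℕ i)
    ... | inj₁ j≤i = disjoint-≤ j≤i eq
    ... | inj₂ i≤j = disjoint-≤ i≤j (trans (sym (α-involutive _)) (cong α (sym eq)))

  -- The local form of `IsFactor`: of two arcs with a common end, or with a common start, exactly
  -- one is chosen.
  Alternating : (Arc → Bool) → Set
  Alternating K = (∀ e → K (α e) ≡ not (K e)) × (∀ e → K (β e) ≡ not (K e))

  opaque
    -- On the alternating cycle through `e`, `α e` is the first backward arc and `βα e` the next
    -- forward arc. The rule for `β` follows because `β e` is `βα (α e)`.
    isFactor⇒alternating : ∀ {K} → IsFactor digraph K → Alternating K
    isFactor⇒alternating {K} factor = on-α , on-β
      where
      on-α : ∀ e → K (α e) ≡ not (K e)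
      on-α e with factor (alternatingCycle e)
      ... | inj₁ h = trans (proj₂ (h zero)) (cong not (sym (proj₁ (h zero))))
      ... | inj₂ h = trans (proj₂ (h zero)) (cong not (sym (proj₁ (h zero))))
      on-βα : ∀ e → K (βα e) ≡ K e
      on-βα e with factor (alternatingCycle e) | Orbit.at-next (orbit-βα e) zero
      ... | inj₁ h | eq = trans (cong K (sym eq)) (trans (proj₁ (h (next zero))) (sym (proj₁ (h zero))))
      ... | inj₂ h | eq = trans (cong K (sym eq)) (trans (proj₁ (h (next zero))) (sym (proj₁ (h zero))))
      on-β : ∀ e → K (β e) ≡ not (K e)
      on-β e = begin
        K (β e)          ≡⟨ cong (K ∘ β) (α-involutive e) ⟨
        K (βα (α e))     ≡⟨ on-βα (α e) ⟩
        K (α e)          ≡⟨ on-α e ⟩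
        not (K e)        ∎

    alternating⇒isFactor : ∀ {K} → Alternating K → IsFactor digraph K
    alternating⇒isFactor {K} (on-α , on-β) C = go r>0 forward backward forward≢backward common-end common-start
      where
      open AlternatingCycle C
      -- The length and the arcs become arguments, so that `r` can be matched as a successor. The
      -- choice made at index `zero` then spreads over the cycle through `next`.
      go : ∀ {r} → r > 0 → (f b : Fin r → Arc) → (∀ i j → f i ≢ b j) → (∀ i → end (f i) ≡ end (b i)) →
        (∀ i → start (b i) ≡ start (f (next i))) →
          (∀ i → K (f i) ≡ true × K (b i) ≡ false) ⊎ (∀ i → K (f i) ≡ false × K (b i) ≡ true)
      go {suc r} _ f b f≢b f-b b-f = by-first (K (f zero)) refl
        where
        flips : ∀ i → K (b i) ≡ not (K (f i))
        flips i with sameEnd (sym (f-b i))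
        ... | inj₁ eq = contradiction (sym eq) (f≢b i i)
        ... | inj₂ eq = trans (cong K eq) (on-α (f i))
        flips-next : ∀ i → K (f (next i)) ≡ K (f i)
        flips-next i with sameStart (sym (b-f i))
        ... | inj₁ eq = contradiction eq (f≢b (next i) i)
        ... | inj₂ eq = begin
          K (f (next i))       ≡⟨ cong K eq ⟩
          K (β (b i))          ≡⟨ on-β (b i) ⟩
          not (K (b i))        ≡⟨ cong not (flips i) ⟩
          not (not (K (f i)))  ≡⟨ Bool.not-involutive _ ⟩
          K (f i)              ∎
        constant : ∀ i → K (f i) ≡ K (f zero)
        constant = next-closed⇒all (λ i → K (f i) ≡ K (f zero)) (λ i → trans (flips-next i)) {zero} refl
        by-first : ∀ c → K (f zero) ≡ c →
          (∀ i → K (f i) ≡ true × K (b i) ≡ false) ⊎ (∀ i → K (f i) ≡ false × K (b i) ≡ true)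
        by-first true  eq = inj₁ λ i → let p = trans (constant i) eq in p , trans (flips i) (cong not p)
        by-first false eq = inj₂ λ i → let p = trans (constant i) eq in p , trans (flips i) (cong not p)

module Factor (F : TwoDigraph n) (K : Fin (TwoDigraph.∣A∣ F) → Bool)
  (alternating : Alternation.Alternating F K) where
  open TwoDigraph F
  open Alternation F

  opaque
    arc-out : ∀ v → (∃ λ i → v ≡ exit i) ⊎ (∃ λ e → start e ≡ v × K e ≡ true)
    arc-out v = by-degree (degrees v)
      where
      by-arcs : OutDegree digraph v 2 → ∃ λ e → start e ≡ v × K e ≡ true
      by-arcs out-2 with Enumeration.at out-2 zero | Enumeration.sound out-2 zero
      ... | e | refl with K e in Ke
      ...   | true  = e , refl , Ke
      ...   | false = β e , start-β e , trans (proj₂ alternating e) (cong not Ke)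
      by-degree : IsEntry digraph v ⊎ IsExit digraph v ⊎ IsSaturated digraph v →
        (∃ λ i → v ≡ exit i) ⊎ (∃ λ e → start e ≡ v × K e ≡ true)
      by-degree (inj₁ (_ , out-2))        = inj₂ (by-arcs out-2)
      by-degree (inj₂ (inj₂ (_ , out-2))) = inj₂ (by-arcs out-2)
      by-degree (inj₂ (inj₁ v-exit))      = let i , eq = Exits.complete v-exit in inj₁ (i , sym eq)

    arc-in : ∀ v → (∃ λ i → v ≡ entry i) ⊎ (∃ λ e → end e ≡ v × K e ≡ true)
    arc-in v = by-degree (degrees v)
      where
      by-arcs : InDegree digraph v 2 → ∃ λ e → end e ≡ v × K e ≡ true
      by-arcs in-2 with Enumeration.at in-2 zero | Enumeration.sound in-2 zero
      ... | e | refl with K e in Ke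
      ...   | true  = e , refl , Ke
      ...   | false = α e , end-α e , trans (proj₁ alternating e) (cong not Ke)
      by-degree : IsEntry digraph v ⊎ IsExit digraph v ⊎ IsSaturated digraph v →
        (∃ λ i → v ≡ entry i) ⊎ (∃ λ e → end e ≡ v × K e ≡ true)
      by-degree (inj₁ v-entry)           = let i , eq = Entries.complete v-entry in inj₁ (i , sym eq)
      by-degree (inj₂ (inj₁ (in-2 , _))) = inj₂ (by-arcs in-2)
      by-degree (inj₂ (inj₂ (in-2 , _))) = inj₂ (by-arcs in-2)

  flipped : ∀ {e e′} → K e ≡ true → K e′ ≡ true → K e′ ≢ not (K e)
  flipped Ke Ke′ eq rewrite Ke | Ke′ with () ← eq

  start-injective : ∀ {e e′} → K e ≡ true → K e′ ≡ true → start e ≡ start e′ → e ≡ e′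
  start-injective {e} {e′} Ke Ke′ eq with sameStart (sym eq)
  ... | inj₁ e′≡e  = sym e′≡e
  ... | inj₂ e′≡βe = contradiction (trans (cong K e′≡βe) (proj₂ alternating e)) (flipped Ke Ke′)

  end-injective : ∀ {e e′} → K e ≡ true → K e′ ≡ true → end e ≡ end e′ → e ≡ e′
  end-injective {e} {e′} Ke Ke′ eq with sameEnd (sym eq)
  ... | inj₁ e′≡e  = sym e′≡e
  ... | inj₂ e′≡αe = contradiction (trans (cong K e′≡αe) (proj₁ alternating e)) (flipped Ke Ke′)

  step-to step-from : Fin ∣V∣ → Fin ∣V∣
  step-to v   = [ (λ (i , _) → entry i) , (λ (e , _) → end e) ]′ (arc-out v)
  step-from v = [ (λ (i , _) → exit i) , (λ (e , _) → start e) ]′ (arc-in v)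

  to-exit : ∀ i → step-to (exit i) ≡ entry i
  to-exit i with arc-out (exit i)
  ... | inj₁ (j , eq)     = cong entry (sym (Exits.injective eq))
  ... | inj₂ (e , eq , _) = contradiction eq (start≢exit e i)

  to-start : ∀ {e} → K e ≡ true → step-to (start e) ≡ end e
  to-start {e} Ke with arc-out (start e)
  ... | inj₁ (j , eq)        = contradiction eq (start≢exit e j)
  ... | inj₂ (e′ , eq , Ke′) = cong end (start-injective Ke′ Ke eq)

  from-entry : ∀ i → step-from (entry i) ≡ exit i
  from-entry i with arc-in (entry i)
  ... | inj₁ (j , eq)     = cong exit (sym (Entries.injective eq))
  ... | inj₂ (e , eq , _) = contradiction eq (end≢entry e i)

  from-end : ∀ {e} → K e ≡ true → step-from (end e) ≡ start e
  from-end {e} Ke with arc-in (end e)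
  ... | inj₁ (j , eq)        = contradiction eq (end≢entry e j)
  ... | inj₂ (e′ , eq , Ke′) = cong start (end-injective Ke′ Ke eq)

  to-from : ∀ v → step-to (step-from v) ≡ v
  to-from v with arc-in v
  ... | inj₁ (i , eq)      = trans (to-exit i) (sym eq)
  ... | inj₂ (e , eq , Ke) = trans (to-start Ke) eq

  from-to : ∀ v → step-from (step-to v) ≡ v
  from-to v with arc-out v
  ... | inj₁ (i , eq)      = trans (from-entry i) (sym eq)
  ... | inj₂ (e , eq , Ke) = trans (from-end Ke) eq

  Φ : Permutation′ ∣V∣
  Φ = permutation step-to step-from to-from from-to

  path⇒reach : ∀ {u j} → Path digraph K u (exit j) → Reach step-to exit u j
  path⇒reach ε = here refl
  path⇒reach {j = j} ((e , Ke , refl , refl) ◅ path) =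
    step (λ i eq → start≢exit e i (sym eq)) (subst (λ v → Reach step-to exit v j) (sym (to-start Ke)) (path⇒reach path))

  reach⇒path : ∀ {u j} → Reach step-to exit u j → Path digraph K u (exit j)
  reach⇒path (here refl) = ε
  reach⇒path {u} (step u∉ r) with arc-out u
  ... | inj₁ (i , eq)        = contradiction (sym eq) (u∉ i)
  ... | inj₂ (e , refl , Ke) = (e , Ke , refl , refl) ◅ reach⇒path r

  exit? : ∀ v → Dec (∃ λ j → exit j ≡ v)
  exit? v = Fin.any? (λ j → exit j Fin.≟ v)

  meets⇒reach : ∀ k {v j} → exit j ≡ fold v step-to k → ∃ λ j → Reach step-to exit v j
  meets⇒reach zero    eq = _ , here (sym eq)
  meets⇒reach (suc k) {v} eq with exit? v
  ... | yes (j , eq′) = j , here (sym eq′)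
  ... | no ¬exit      =
    let j , r = meets⇒reach k (trans eq (fold-suc v step-to k)) in j , step (λ i eq → ¬exit (i , eq)) r

  opaque
    -- The orbit of `v` under `Φ` is a cycle. If it avoided all exit vertices, it would never jump,
    -- and its arcs would form a directed cycle in `K`.
    acyclic⇒returning : ¬ (∃ λ (Z : DirectedCycle digraph) → ∀ i → K (DirectedCycle.arc Z i) ≡ true) →
      Returning Φ exit
    acyclic⇒returning acyclic v with Fin.any? (λ i → exit? (Orbit.at (permutation-orbit Φ v) i))
    ... | yes (i , j , eq) = meets⇒reach (toℕ i) eq
    ... | no ¬exit         = contradiction (record
        { arc         = λ i → proj₁ (arc-at i)
        ; consecutive = consecutive
        ; simple      = λ {i} {j} eq → at-injective
            (trans (sym (proj₁ (proj₂ (arc-at i)))) (trans eq (proj₁ (proj₂ (arc-at j)))))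
        } , λ i → proj₂ (proj₂ (arc-at i))) acyclic
      where
      open Orbit (permutation-orbit Φ v)
      arc-at : ∀ i → ∃ λ e → start e ≡ at i × K e ≡ true
      arc-at i with arc-out (at i)
      ... | inj₁ (j , eq) = contradiction (i , j , sym eq) ¬exit
      ... | inj₂ found    = found
      consecutive : ∀ i → end (proj₁ (arc-at i)) ≡ start (proj₁ (arc-at (next i)))
      consecutive i = let e , s , Ke = arc-at i ; _ , s′ , _ = arc-at (next i) in begin
        end e                  ≡⟨ to-start Ke ⟨
        step-to (start e)      ≡⟨ cong step-to s ⟩
        step-to (at i)         ≡⟨ at-next i ⟨
        at (next i)            ≡⟨ s′ ⟨
        _                      ∎

  module _ (returning : Returning Φ exit) where

    opaque
      exit-return : SignedReturn Φ exit
      exit-return = signedReturn Φ exit Exits.injective returning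

    route : Permutation′ n
    route = proj₁ exit-return

    route-isRoute : IsRoute F K route
    -- `Φ` jumps from `exit i` to `entry i`, so the first return of `exit i` is where the path from
    -- `entry i` ends.
    route-isRoute i = reach⇒path (subst (λ v → Reach step-to exit v (route ⟨$⟩ʳ i))
      (to-exit i) (proj₁ (proj₂ exit-return) i))

    -- A path in `K` to an exit vertex is a first hit of the exits, and first hits are unique; hence
    -- every route of `K` equals the first return permutation.
    π-route : ∀ {p} → IsRoute F K p → π p ≡ π Φ ℙ.+ parity (∣V∣ + n)
    π-route {p} isRoute = trans
      (π-cong {σ = p} {route} (λ i → Reach-unique Exits.injective
        (path⇒reach (isRoute i)) (path⇒reach (route-isRoute i))))
      (proj₂ (proj₂ exit-return))

-- Uniformity of the set of open routes

module _ (F : TwoDigraph n) where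
  open TwoDigraph F
  open Alternation F

  -- Φ_K followed by the inverse of Φ_K′ moves the vertices along the alternating
  -- cycles on which K and K′ differ.
  π-Φ : AllACsOdd digraph → ∀ {K K′} (a : Alternating K) (a′ : Alternating K′) →
    π (Factor.Φ F K a) ≡ π (Factor.Φ F K′ a′)
  π-Φ odd {K} {K′} a a′ = ℙ.+-cancelʳ-≡ (π Φ′.Φ) _ _ (begin
    π Φ.Φ ℙ.+ π Φ′.Φ          ≡⟨ cong (π Φ.Φ ℙ.+_) (π-flip Φ′.Φ) ⟨
    π Φ.Φ ℙ.+ π (flip Φ′.Φ)   ≡⟨ π-∘ Φ.Φ (flip Φ′.Φ) ⟨
    π ψ                       ≡⟨ oddPeriods⇒even ψ oddPeriod ⟩
    0ℙ                        ≡⟨ ℙ.p+p≡0ℙ (π Φ′.Φ) ⟨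
    π Φ′.Φ ℙ.+ π Φ′.Φ         ∎)
    where
    module Φ  = Factor F K a
    module Φ′ = Factor F K′ a′
    ψ = Φ.Φ ∘ₚ flip Φ′.Φ
    -- One step of `ψ` follows the arc `e′` of `K` to its end and goes back along `α e′`, which
    -- belongs to `K′`, to the start of `βα e′`. The invariant survives because `α` and `β` each
    -- flip membership in both factors.
    along : ∀ e → K e ≡ true → K′ e ≡ false → ∀ k → let e′ = fold e βα k in
      fold (start e) (ψ ⟨$⟩ʳ_) k ≡ start e′ × K e′ ≡ true × K′ e′ ≡ false
    along e Ke K′e zero    = refl , Ke , K′e
    along e Ke K′e (suc k) with along e Ke K′e k
    ... | at-start , Ke′ , K′e′ =
        (begin
          ψ ⟨$⟩ʳ fold (start e) (ψ ⟨$⟩ʳ_) k    ≡⟨ cong (ψ ⟨$⟩ʳ_) at-start ⟩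
          Φ′.step-from (Φ.step-to (start e′))  ≡⟨ cong Φ′.step-from (Φ.to-start Ke′) ⟩
          Φ′.step-from (end e′)                ≡⟨ cong Φ′.step-from (end-α e′) ⟨
          Φ′.step-from (end (α e′))            ≡⟨ Φ′.from-end (trans (proj₁ a′ e′) (cong not K′e′)) ⟩
          start (α e′)                         ≡⟨ start-β (α e′) ⟨
          start (βα e′)                        ∎)
      , trans (proj₂ a (α e′)) (cong not (trans (proj₁ a e′) (cong not Ke′)))
      , trans (proj₂ a′ (α e′)) (cong not (trans (proj₁ a′ e′) (cong not K′e′)))
      where e′ = fold e βα k
    oddPeriod : ∀ v → OddPeriod (ψ ⟨$⟩ʳ_) v
    oddPeriod v with Φ.arc-out v
    ... | inj₁ (i , refl) = 1 , refl , trans (cong Φ′.step-from (Φ.to-exit i)) (Φ′.from-entry i)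
    ... | inj₂ (e , refl , Ke) with K′ e in K′e
    ...   | true  = 1 , refl , trans (cong Φ′.step-from (Φ.to-start Ke)) (Φ′.from-end K′e)
    -- This period is the half-length `r` of the alternating cycle through `e`, which is odd by
    -- hypothesis.
    ...   | false = suc length-1 , odd (alternatingCycle e)
                  , trans (proj₁ (along e Ke K′e (suc length-1))) (cong start period)
      where open Orbit (orbit-βα e)

  openRoutes-uniform : Open digraph → AllACsOdd digraph → Uniform (OpenRoutes F)
  openRoutes-uniform (K , K-open@(factor , acyclic)) odd = record
    { parityOf = π Φ.Φ ℙ.+ parity (∣V∣ + n)
    ; nonEmpty = Φ.route returning , K , K-open , Φ.route-isRoute returning
    ; uniform  = λ {p} (K′ , (factor′ , acyclic′) , isRoute) →
        let a′ = isFactor⇒alternating factor′ in trans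
        (Factor.π-route F K′ a′ (Factor.acyclic⇒returning F K′ a′ acyclic′) {p} isRoute)
        (cong (ℙ._+ parity (∣V∣ + n)) (π-Φ odd a′ a))
    }
    where
    a = isFactor⇒alternating factor
    module Φ = Factor F K a
    returning = Φ.acyclic⇒returning acyclic

  factor-route : ∀ {K} → IsOpenFactor digraph K → ∃ λ p → IsRoute F K p
  factor-route {K} (factor , acyclic) = Φ.route returning , Φ.route-isRoute returning
    where
    module Φ = Factor F K (isFactor⇒alternating factor)
    returning = Φ.acyclic⇒returning acyclic

-- Splicing

module _ {A B : Set} (_≟_ : (a a′ : A) → Dec (a ≡ a′)) (f : Fin n → A) (t : Fin n → B) where

  -- One half of a normal form for glued vertices: the points `f i` move to their partners on the
  -- other side and all others stay.
  redirect : A → A ⊎ B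
  redirect a with Fin.any? (λ i → f i ≟ a)
  ... | yes (i , _) = inj₂ (t i)
  ... | no _        = inj₁ a

  redirect-hit : Injective _≡_ _≡_ f → ∀ i → redirect (f i) ≡ inj₂ (t i)
  redirect-hit f-inj i with Fin.any? (λ j → f j ≟ f i)
  ... | yes (j , eq) = cong (inj₂ ∘ t) (f-inj eq)
  ... | no ¬hit      = contradiction (i , refl) ¬hit

  redirect-miss : ∀ {a} → (∀ i → f i ≢ a) → redirect a ≡ inj₁ a
  redirect-miss {a} miss with Fin.any? (λ j → f j ≟ a)
  ... | yes (j , eq) = contradiction eq (miss j)
  ... | no _         = refl

  data Redirected (a : A) : Set where
    hit  : ∀ i → f i ≡ a → redirect a ≡ inj₂ (t i) → Redirected a
    miss : (∀ i → f i ≢ a) → redirect a ≡ inj₁ a → Redirected a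

  redirected : Injective _≡_ _≡_ f → ∀ a → Redirected a
  redirected f-inj a with Fin.any? (λ j → f j ≟ a)
  ... | yes (j , refl) = hit j refl (redirect-hit f-inj j)
  ... | no ¬hit        = let miss! = λ i eq → ¬hit (i , eq) in miss miss! (redirect-miss miss!)

module Splicing (F F′ : TwoDigraph n) (x y : Permutation′ n) where
  module F  = TwoDigraph F
  module F′ = TwoDigraph F′
  module A  = Alternation F
  module A′ = Alternation F′
  open Digraph (splice F F′ x y) public

  ∼-sym : ∀ {u v} → u ∼ v → v ∼ u
  ∼-sym = Setoid.sym vertices

  ∼-trans : ∀ {u v w} → u ∼ v → v ∼ w → u ∼ w
  ∼-trans = Setoid.trans vertices

  ∼-reflexive : ∀ {u v} → u ≡ v → u ∼ v
  ∼-reflexive = Setoid.reflexive vertices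

  exit∼entry′ : ∀ i → inj₁ (F.exit i) ∼ inj₂ (F′.entry (x ⟨$⟩ʳ i))
  exit∼entry′ i = Eq.return (exit-entry′ i)

  exit′∼entry : ∀ i → inj₂ (F′.exit i) ∼ inj₁ (F.entry (y ⟨$⟩ʳ i))
  exit′∼entry i = Eq.return (exit′-entry i)

  redirect-exit : Fin F.∣V∣ → Vertex
  redirect-exit = redirect Fin._≟_ F.exit (λ i → F′.entry (x ⟨$⟩ʳ i))

  redirect-exit′ : Fin F′.∣V∣ → Fin F′.∣V∣ ⊎ Fin F.∣V∣
  redirect-exit′ = redirect Fin._≟_ F′.exit (λ i → F.entry (y ⟨$⟩ʳ i))

  redirect-entry : Fin F.∣V∣ → Vertex
  redirect-entry = redirect Fin._≟_ F.entry (λ i → F′.exit (y ⟨$⟩ˡ i))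

  redirect-entry′ : Fin F′.∣V∣ → Fin F′.∣V∣ ⊎ Fin F.∣V∣
  redirect-entry′ = redirect Fin._≟_ F′.entry (λ i → F.exit (x ⟨$⟩ˡ i))

  -- Normal forms of the vertices: rep avoids the exit vertices, so that it
  -- fixes the starts of the arcs, and rep⁻ avoids the entry vertices.
  rep rep⁻ : Vertex → Vertex
  rep  = [ redirect-exit , Sum⊎.swap ∘ redirect-exit′ ]′
  rep⁻ = [ redirect-entry , Sum⊎.swap ∘ redirect-entry′ ]′

  -- It suffices to check the two kinds of gluing: `rep` moves the exit vertex to the entry vertex
  -- glued to it, and keeps that entry vertex since it is not an exit.
  rep-cong : ∀ {u v} → u ∼ v → rep u ≡ rep v
  rep-cong = Eq.gfold isEquivalence rep λ
    { (exit-entry′ i) → trans (redirect-hit Fin._≟_ _ _ A.Exits.injective i)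
        (sym (cong Sum⊎.swap (redirect-miss Fin._≟_ _ _ (λ j eq → A′.entry≢exit _ j (sym eq)))))
    ; (exit′-entry i) → trans (cong Sum⊎.swap (redirect-hit Fin._≟_ _ _ A′.Exits.injective i))
        (sym (redirect-miss Fin._≟_ _ _ (λ j eq → A.entry≢exit _ j (sym eq)))) }

  rep⁻-cong : ∀ {u v} → u ∼ v → rep⁻ u ≡ rep⁻ v
  rep⁻-cong = Eq.gfold isEquivalence rep⁻ λ
    { (exit-entry′ i) → trans (redirect-miss Fin._≟_ _ _ (λ j eq → A.entry≢exit j _ eq))
        (sym (cong Sum⊎.swap (trans (redirect-hit Fin._≟_ _ _ A′.Entries.injective _)
                                    (cong (inj₂ ∘ F.exit) (inverseˡ x)))))
    ; (exit′-entry i) → trans (cong Sum⊎.swap (redirect-miss Fin._≟_ _ _ (λ j eq → A′.entry≢exit j _ eq)))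
        (sym (trans (redirect-hit Fin._≟_ _ _ A.Entries.injective _) (cong (inj₂ ∘ F′.exit) (inverseˡ y)))) }

  rep-start : ∀ a → rep (start a) ≡ start a
  rep-start (inj₁ e) = redirect-miss Fin._≟_ _ _ (λ i eq → A.start≢exit e i (sym eq))
  rep-start (inj₂ e) = cong Sum⊎.swap (redirect-miss Fin._≟_ _ _ (λ i eq → A′.start≢exit e i (sym eq)))

  rep⁻-end : ∀ a → rep⁻ (end a) ≡ end a
  rep⁻-end (inj₁ e) = redirect-miss Fin._≟_ _ _ (λ i eq → A.end≢entry e i (sym eq))
  rep⁻-end (inj₂ e) = cong Sum⊎.swap (redirect-miss Fin._≟_ _ _ (λ i eq → A′.end≢entry e i (sym eq)))

  -- No arc starts at an exit vertex, so `rep` fixes both starts and gluing cannot identify distinct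
  -- ones. For ends, `rep⁻` does the same.
  start-rigid : ∀ a b → start a ∼ start b → start a ≡ start b
  start-rigid a b s∼s = trans (sym (rep-start a)) (trans (rep-cong s∼s) (rep-start b))

  end-rigid : ∀ a b → end a ∼ end b → end a ≡ end b
  end-rigid a b t∼t = trans (sym (rep⁻-end a)) (trans (rep⁻-cong t∼t) (rep⁻-end b))

  ¬Exit : Vertex → Set
  ¬Exit u = (∀ i → inj₁ (F.exit i) ≢ u) × (∀ i → inj₂ (F′.exit i) ≢ u)

  rep-¬exit : ∀ u → ¬Exit (rep u)
  rep-¬exit (inj₁ v) with redirected Fin._≟_ F.exit (λ i → F′.entry (x ⟨$⟩ʳ i)) A.Exits.injective v
  ... | hit i _ eq rewrite eq = (λ _ ()) , λ j eq′ → A′.entry≢exit _ j (sym (Sum⊎.inj₂-injective eq′))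
  ... | miss ¬exit eq rewrite eq = (λ j eq′ → ¬exit j (Sum⊎.inj₁-injective eq′)) , λ _ ()
  rep-¬exit (inj₂ v) with redirected Fin._≟_ F′.exit (λ i → F.entry (y ⟨$⟩ʳ i)) A′.Exits.injective v
  ... | hit i _ eq rewrite eq = (λ j eq′ → A.entry≢exit _ j (sym (Sum⊎.inj₁-injective eq′))) , λ _ ()
  ... | miss ¬exit eq rewrite eq = (λ _ ()) , λ j eq′ → ¬exit j (Sum⊎.inj₂-injective eq′)

  rep-∼ : ∀ u → rep u ∼ u
  rep-∼ (inj₁ v) with redirected Fin._≟_ F.exit (λ i → F′.entry (x ⟨$⟩ʳ i)) A.Exits.injective v
  ... | hit i refl eq rewrite eq = ∼-sym (exit∼entry′ i)
  ... | miss _ eq rewrite eq = ∼-reflexive refl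
  rep-∼ (inj₂ v) with redirected Fin._≟_ F′.exit (λ i → F.entry (y ⟨$⟩ʳ i)) A′.Exits.injective v
  ... | hit i refl eq rewrite eq = ∼-sym (exit′∼entry i)
  ... | miss _ eq rewrite eq = ∼-reflexive refl

-- From open routes to a Hamiltonian cycle

-- The successor arc g generates a directed cycle, and two vertices are related
-- by R if they lie on the same cycle.
module FromRoutes {n} (F F′ : TwoDigraph (suc n)) (x y : Permutation′ (suc n))
  (K : Fin (TwoDigraph.∣A∣ F) → Bool) (K′ : Fin (TwoDigraph.∣A∣ F′) → Bool)
  (K-open : IsOpenFactor (TwoDigraph.digraph F) K) (K′-open : IsOpenFactor (TwoDigraph.digraph F′) K′)
  {p q : Permutation′ (suc n)} (p-route : IsRoute F K p) (q-route : IsRoute F′ K′ q) where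
  open Splicing F F′ x y
  module Φ  = Factor F K (A.isFactor⇒alternating (proj₁ K-open))
  module Φ′ = Factor F′ K′ (A′.isFactor⇒alternating (proj₁ K′-open))

  chosen : Arc → Bool
  chosen = [ K , K′ ]′

  start-injective : ∀ {a b} → chosen a ≡ true → chosen b ≡ true → start a ≡ start b → a ≡ b
  start-injective {inj₁ _} {inj₁ _} Ka Kb eq = cong inj₁ (Φ.start-injective Ka Kb (Sum⊎.inj₁-injective eq))
  start-injective {inj₂ _} {inj₂ _} Ka Kb eq = cong inj₂ (Φ′.start-injective Ka Kb (Sum⊎.inj₂-injective eq))

  end-injective : ∀ {a b} → chosen a ≡ true → chosen b ≡ true → end a ≡ end b → a ≡ b
  end-injective {inj₁ _} {inj₁ _} Ka Kb eq = cong inj₁ (Φ.end-injective Ka Kb (Sum⊎.inj₁-injective eq))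
  end-injective {inj₂ _} {inj₂ _} Ka Kb eq = cong inj₂ (Φ′.end-injective Ka Kb (Sum⊎.inj₂-injective eq))

  leave : ∀ u → ¬Exit u → ∃ λ a → start a ≡ u × chosen a ≡ true
  leave (inj₁ v) (¬exit , _) with Φ.arc-out v
  ... | inj₁ (i , eq)      = contradiction (cong inj₁ (sym eq)) (¬exit i)
  ... | inj₂ (e , eq , Ke) = inj₁ e , cong inj₁ eq , Ke
  leave (inj₂ v) (_ , ¬exit) with Φ′.arc-out v
  ... | inj₁ (i , eq)      = contradiction (cong inj₂ (sym eq)) (¬exit i)
  ... | inj₂ (e , eq , Ke) = inj₂ e , cong inj₂ eq , Ke

  opaque
    -- The chosen arc leaving the class of `u` is sought at its representative outside the exit
    -- vertices, where a chosen arc is sure to start.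
    out : Vertex → Arc
    out u = proj₁ (leave (rep u) (rep-¬exit u))

    start-out : ∀ u → start (out u) ≡ rep u
    start-out u = proj₁ (proj₂ (leave (rep u) (rep-¬exit u)))

    chosen-out : ∀ u → chosen (out u) ≡ true
    chosen-out u = proj₂ (proj₂ (leave (rep u) (rep-¬exit u)))

  start-out∼ : ∀ u → start (out u) ∼ u
  start-out∼ u = ∼-trans (∼-reflexive (start-out u)) (rep-∼ u)

  out-cong : ∀ {u v} → u ∼ v → out u ≡ out v
  out-cong {u} {v} u∼v = start-injective (chosen-out u) (chosen-out v)
    (trans (start-out u) (trans (rep-cong u∼v) (sym (start-out v))))

  out-start : ∀ a → chosen a ≡ true → out (start a) ≡ a
  out-start a Ka = start-injective (chosen-out (start a)) Ka (trans (start-out (start a)) (rep-start a))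

  g : Arc → Arc
  g a = out (end a)

  -- Equal successors mean that the ends of `a` and `b` are glued, hence equal by `end-rigid`;
  -- distinct chosen arcs have distinct ends.
  g-injective : ∀ {a b} → chosen a ≡ true → chosen b ≡ true → g a ≡ g b → a ≡ b
  g-injective {a} {b} Ka Kb eq = end-injective Ka Kb (end-rigid a b
    (∼-trans (∼-sym (start-out∼ (end a))) (∼-trans (∼-reflexive (cong start eq)) (start-out∼ (end b)))))

  opaque
    orbit-g : ∀ {a} → chosen a ≡ true → Orbit g a
    orbit-g = orbit (join F.∣A∣ F′.∣A∣)
      (λ eq → trans (sym (Fin.splitAt-join F.∣A∣ F′.∣A∣ _))
        (trans (cong (splitAt F.∣A∣) eq) (Fin.splitAt-join F.∣A∣ F′.∣A∣ _)))
      (λ a → chosen a ≡ true) (λ {a} _ → chosen-out (end a)) (λ {a} {b} → g-injective {a} {b})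

  R : Vertex → Vertex → Set
  R u v = Joinable g (out u) (out v)

  R-trans : ∀ {u v w} → R u v → R v w → R u w
  R-trans = joinable-trans g

  ∼⇒R : ∀ {u v} → u ∼ v → R u v
  ∼⇒R u∼v = joinable-refl g (out-cong u∼v)

  R-arc : ∀ a → chosen a ≡ true → R (start a) (end a)
  R-arc a Ka = 1 , 0 , cong g (out-start a Ka)

  R-path : ∀ {u v} → Path F.digraph K u v → R (inj₁ u) (inj₁ v)
  R-path ε = joinable-refl g refl
  R-path ((e , Ke , refl , refl) ◅ path) = R-trans (R-arc (inj₁ e) Ke) (R-path path)

  R-path′ : ∀ {u v} → Path F′.digraph K′ u v → R (inj₂ u) (inj₂ v)
  R-path′ ε = joinable-refl g refl
  R-path′ ((e , Ke , refl , refl) ◅ path) = R-trans (R-arc (inj₂ e) Ke) (R-path′ path)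

  σ : Permutation′ (suc n)
  σ = p ∘ₚ x ∘ₚ q ∘ₚ y

  -- One turn of the spliced cycle: a path through `F`, the gluing by `x`, a path through `F′`, and
  -- the gluing by `y`.
  R-σ : ∀ i → R (inj₁ (F.entry i)) (inj₁ (F.entry (σ ⟨$⟩ʳ i)))
  R-σ i = R-trans (R-path (p-route i)) (R-trans (∼⇒R (exit∼entry′ _))
    (R-trans (R-path′ (q-route (x ⟨$⟩ʳ (p ⟨$⟩ʳ i)))) (∼⇒R (exit′∼entry _))))

  module _ (cycle : FullCycle σ) where
    c = proj₁ cycle

    origin : Vertex
    origin = inj₁ (F.entry (c ⟨$⟩ʳ zero))

    origin-R-entry : ∀ i → R origin (inj₁ (F.entry i))
    origin-R-entry i = subst (λ j → R origin (inj₁ (F.entry j))) (inverseʳ c)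
      (next-closed⇒all (λ i → R origin (inj₁ (F.entry (c ⟨$⟩ʳ i))))
        (λ i r → R-trans r
          (subst (λ j → R (inj₁ (F.entry (c ⟨$⟩ʳ i))) (inj₁ (F.entry j))) (proj₂ cycle i) (R-σ (c ⟨$⟩ʳ i))))
        {zero} (joinable-refl g refl) (c ⟨$⟩ˡ i))

    origin-R : ∀ u → R origin u
    origin-R (inj₁ v) =
      let j , r = Φ.acyclic⇒returning (proj₂ K-open) v
          -- The path through `v` ends at `exit j`, as does the path from entry `i`, so both belong
          -- to one cycle.
          i = p ⟨$⟩ˡ j
      in R-trans (R-trans (origin-R-entry i) (R-path (p-route i)))
        (subst (λ k → R (inj₁ (F.exit k)) (inj₁ v)) (sym (inverseʳ p)) (joinable-sym g (R-path (Φ.reach⇒path r))))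
    origin-R (inj₂ v) =
      let j , r = Φ′.acyclic⇒returning (proj₂ K′-open) v
      in R-trans (origin-R-entry (y ⟨$⟩ʳ j))
        (joinable-sym g (R-trans (R-path′ (Φ′.reach⇒path r)) (∼⇒R (exit′∼entry j))))

    hamiltonian : Hamiltonian (splice F F′ x y)
    hamiltonian = record
      { arc         = at
      ; consecutive = λ i → ∼-trans (∼-sym (start-out∼ (end (at i)))) (∼-reflexive (cong start (sym (at-next i))))
      ; simple      = λ {i} {j} s∼s → at-injective
          (start-injective (chosen-fold (toℕ i)) (chosen-fold (toℕ j)) (start-rigid (at i) (at j) s∼s))
      } , λ u →
        let i , eq = joinable⇒at g (orbit-g {out origin} (chosen-out origin))
              (orbit-g {out u} (chosen-out u)) (origin-R u)
        in i , ∼-trans (∼-reflexive (cong start eq)) (start-out∼ u)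
      where
      open Orbit (orbit-g {out origin} (chosen-out origin))
      chosen-fold : ∀ k → chosen (fold (out origin) g k) ≡ true
      chosen-fold zero    = chosen-out origin
      chosen-fold (suc k) = chosen-out _

-- From a Hamiltonian cycle to open routes

does-true : ∀ {P : Set} (P? : Dec P) → does P? ≡ true → P
does-true (yes p) _ = p

exactly-one : ∀ {P Q : Set} (P? : Dec P) (Q? : Dec Q) → ¬ (P × Q) → ¬ (¬ P × ¬ Q) →
  does Q? ≡ not (does P?)
exactly-one (yes p) (yes q) ¬both ¬neither = contradiction (p , q) ¬both
exactly-one (yes p) (no ¬q) ¬both ¬neither = refl
exactly-one (no ¬p) (yes q) ¬both ¬neither = refl
exactly-one (no ¬p) (no ¬q) ¬both ¬neither = contradiction (¬p , ¬q) ¬neither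

module FromCycle (F F′ : TwoDigraph n) (x y : Permutation′ n) (H : Hamiltonian (splice F F′ x y)) where
  open Splicing F F′ x y
  open DirectedCycle (proj₁ H)

  covers : ∀ v → ∃ λ i → start (arc i) ∼ v
  covers = proj₂ H

  Used : Arc → Set
  Used a = ∃ λ i → arc i ≡ a

  used? : ∀ a → Dec (Used a)
  used? a = Fin.any? (λ i → Sum⊎.≡-dec Fin._≟_ Fin._≟_ (arc i) a)

  used-start : ∀ {a b} → Used a → Used b → start a ∼ start b → a ≡ b
  used-start (i , refl) (j , refl) s∼s = cong arc (simple s∼s)

  used-end : ∀ {a b} → Used a → Used b → end a ∼ end b → a ≡ b
  used-end (i , refl) (j , refl) t∼t = cong arc (next-injective (simple
    (∼-trans (∼-sym (consecutive i)) (∼-trans t∼t (consecutive j)))))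

  opaque
    leaves : ∀ a → ∃ λ b → Used b × start b ≡ start a
    leaves a = let i , s∼ = covers (start a) in arc i , (i , refl) , start-rigid (arc i) a s∼

    enters : ∀ a → ∃ λ b → Used b × end b ≡ end a
    enters a with i , s∼ ← covers (end a) with j , refl ← next-surjective i =
      arc j , (j , refl) , end-rigid (arc j) a (∼-trans (consecutive j) s∼)

    K : SpanningSubgraph F.digraph
    K e = does (used? (inj₁ e))

    K-used : ∀ {e} → K e ≡ true → Used (inj₁ e)
    K-used {e} = does-true (used? (inj₁ e))

    used-K : ∀ {e} → Used (inj₁ e) → K e ≡ true
    used-K {e} = dec-true (used? (inj₁ e))

    K-flip : ∀ {e e′} → ¬ (Used (inj₁ e) × Used (inj₁ e′)) → ¬ (¬ Used (inj₁ e) × ¬ Used (inj₁ e′)) →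
      K e′ ≡ not (K e)
    K-flip {e} {e′} = exactly-one (used? (inj₁ e)) (used? (inj₁ e′))

  -- The cycle passes through each vertex exactly once, so it uses exactly one of two arcs with a
  -- common start and exactly one of two arcs with a common end.
  K-alternating : A.Alternating K
  K-alternating = on-α , on-β
    where
    on-α : ∀ e → K (A.α e) ≡ not (K e)
    on-α e = K-flip
      (λ (ue , uαe) → A.α≢ e (Sum⊎.inj₁-injective (used-end uαe ue (∼-reflexive (cong inj₁ (A.end-α e))))))
      neither
      where
      neither : ¬ (¬ Used (inj₁ e) × ¬ Used (inj₁ (A.α e)))
      neither (¬ue , ¬uαe) with enters (inj₁ e)
      ... | inj₁ e′ , u , eq with A.sameEnd (Sum⊎.inj₁-injective eq)
      ...   | inj₁ refl = ¬ue u
      ...   | inj₂ refl = ¬uαe u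
    on-β : ∀ e → K (A.β e) ≡ not (K e)
    on-β e = K-flip
      (λ (ue , uβe) → A.β≢ e (Sum⊎.inj₁-injective (used-start uβe ue (∼-reflexive (cong inj₁ (A.start-β e))))))
      neither
      where
      neither : ¬ (¬ Used (inj₁ e) × ¬ Used (inj₁ (A.β e)))
      neither (¬ue , ¬uβe) with leaves (inj₁ e)
      ... | inj₁ e′ , u , eq with A.sameStart (Sum⊎.inj₁-injective eq)
      ...   | inj₁ refl = ¬ue u
      ...   | inj₂ refl = ¬uβe u

  -- A directed cycle in K would be all of H, whereas H passes through the entry
  -- vertices of F.
  K-acyclic : Fin n → ¬ (∃ λ (W : DirectedCycle F.digraph) → ∀ i → K (DirectedCycle.arc W i) ≡ true)
  K-acyclic i₀ (W , W⊆K) = at-entry (covers (inj₁ (F.entry i₀)))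
    where
    module W = DirectedCycle W
    OnW : Pred (Fin _) 0ℓ
    OnW i = ∃ λ j → arc i ≡ inj₁ (W.arc j)
    -- The arc of `H` with the same start as the next arc of `W` is that arc itself, because `H` is
    -- simple.
    onW-next : ∀ i → OnW i → OnW (next i)
    onW-next i (j , eq) with i′ , eq′ ← K-used (W⊆K (next j)) = next j , trans (cong arc (simple
      (∼-trans (∼-sym (consecutive i)) (∼-reflexive (begin
        end (arc i)                       ≡⟨ cong end eq ⟩
        inj₁ (F.end (W.arc j))            ≡⟨ cong inj₁ (W.consecutive j) ⟩
        inj₁ (F.start (W.arc (next j)))   ≡⟨ cong start eq′ ⟨
        start (arc i′)                    ∎))))) eq′
    onW : ∀ i → OnW i
    onW = next-closed⇒all OnW onW-next {proj₁ (K-used (W⊆K zero))} (zero , proj₂ (K-used (W⊆K zero)))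
    -- The arc of `H` leaving entry `i₀` would lie on `W`, whose preceding arc would end at an entry
    -- vertex.
    at-entry : ¬ (∃ λ i → start (arc i) ∼ inj₁ (F.entry i₀))
    at-entry (i , s∼) with j , eq ← onW i with j′ , refl ← next-surjective j =
      A.end≢entry (W.arc j′) i₀ (trans (W.consecutive j′) (Sum⊎.inj₁-injective (begin
        inj₁ (F.start (W.arc j))   ≡⟨ cong start eq ⟨
        start (arc i)              ≡⟨ rep-start (arc i) ⟨
        rep (start (arc i))        ≡⟨ rep-cong s∼ ⟩
        rep (inj₁ (F.entry i₀))
          ≡⟨ redirect-miss Fin._≟_ _ _ (λ k eq′ → A.entry≢exit i₀ k (sym eq′)) ⟩
        inj₁ (F.entry i₀)          ∎)))

  K-open : Fin n → IsOpenFactor F.digraph K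
  K-open i₀ = A.alternating⇒isFactor K-alternating , K-acyclic i₀

glue-swap : (F F′ : TwoDigraph n) (x y : Permutation′ n) → ∀ {u v} →
  EqClosure (Glue F F′ x y) u v → EqClosure (Glue F′ F y x) (Sum⊎.swap u) (Sum⊎.swap v)
glue-swap F F′ x y = Eq.gmap Sum⊎.swap λ { (exit-entry′ i) → exit′-entry i ; (exit′-entry i) → exit-entry′ i }

-- Lets the restriction of the cycle to `F′` be treated as the restriction to the first digraph. The
-- second component keeps track of the arcs of `F′`.
hamiltonian-swap : (F F′ : TwoDigraph n) (x y : Permutation′ n) →
  (H : Hamiltonian (splice F F′ x y)) → ∃ λ (H′ : Hamiltonian (splice F′ F y x)) →
  ∀ {e} → (∃ λ i → DirectedCycle.arc (proj₁ H) i ≡ inj₂ e) → ∃ λ i → DirectedCycle.arc (proj₁ H′) i ≡ inj₁ e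
hamiltonian-swap F F′ x y (Z , covers) = (record
    { arc         = Sum⊎.swap ∘ arc
    ; consecutive = λ i → subst₂ G′._∼_ (end-swap (arc i)) (start-swap (arc (next i))) (glue-swap F F′ x y (consecutive i))
    ; simple      = λ {i} {j} s∼s → simple (subst₂ G._∼_
        (Sum⊎.swap-involutive (G.start (arc i))) (Sum⊎.swap-involutive (G.start (arc j)))
        (glue-swap F′ F y x (subst₂ G′._∼_ (sym (start-swap (arc i))) (sym (start-swap (arc j))) s∼s)))
    } , λ v → let i , s∼ = covers (Sum⊎.swap v) in i
          , subst₂ G′._∼_ (start-swap (arc i)) (Sum⊎.swap-involutive v) (glue-swap F F′ x y s∼))
  , λ (i , eq) → i , cong Sum⊎.swap eq
  where
  open DirectedCycle Z
  module G  = Digraph (splice F F′ x y)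
  module G′ = Digraph (splice F′ F y x)
  start-swap : ∀ a → Sum⊎.swap (G.start a) ≡ G′.start (Sum⊎.swap a)
  start-swap (inj₁ _) = refl
  start-swap (inj₂ _) = refl
  end-swap : ∀ a → Sum⊎.swap (G.end a) ≡ G′.end (Sum⊎.swap a)
  end-swap (inj₁ _) = refl
  end-swap (inj₂ _) = refl

hamiltonian⇒openFactor : (F F′ : TwoDigraph n) (x y : Permutation′ n) → Fin n →
  ((Z , _) : Hamiltonian (splice F F′ x y)) → ∃ λ K →
  IsOpenFactor (TwoDigraph.digraph F) K × (∀ {e} → (∃ λ i → DirectedCycle.arc Z i ≡ inj₁ e) → K e ≡ true)
hamiltonian⇒openFactor F F′ x y i₀ H = K , K-open i₀ , used-K
  where open FromCycle F F′ x y H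

module FromHamiltonian (F F′ : TwoDigraph n) (x y : Permutation′ n)
  (H : Hamiltonian (splice F F′ x y)) where
  open Splicing F F′ x y
  open DirectedCycle (proj₁ H)

  module _ {K : SpanningSubgraph F.digraph} {K′ : SpanningSubgraph F′.digraph}
    (K-open : IsOpenFactor F.digraph K) (K′-open : IsOpenFactor F′.digraph K′)
    (Z⊆K : ∀ {e} → (∃ λ i → arc i ≡ inj₁ e) → K e ≡ true)
    (Z⊆K′ : ∀ {e} → (∃ λ i → arc i ≡ inj₂ e) → K′ e ≡ true)
    (p q : Permutation′ n) (p-route : IsRoute F K p) (q-route : IsRoute F′ K′ q) where
    module Φ  = Factor F K (A.isFactor⇒alternating (proj₁ K-open))
    module Φ′ = Factor F′ K′ (A′.isFactor⇒alternating (proj₁ K′-open))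

    σ : Permutation′ n
    σ = p ∘ₚ x ∘ₚ q ∘ₚ y

    reach : ∀ v → ∃ λ j → Reach Φ.step-to F.exit v j
    reach = Φ.acyclic⇒returning (proj₂ K-open)

    reach′ : ∀ v → ∃ λ j → Reach Φ′.step-to F′.exit v j
    reach′ = Φ′.acyclic⇒returning (proj₂ K′-open)

    -- For a vertex of F, the entry vertex of F from which the path through it
    -- starts; for a vertex of F′, the entry vertex of F glued to the end of the
    -- path through it.
    label : Vertex → Fin n
    label (inj₁ v) = p ⟨$⟩ˡ proj₁ (reach v)
    label (inj₂ v) = y ⟨$⟩ʳ proj₁ (reach′ v)

    label₁ : ∀ {v j} → Reach Φ.step-to F.exit v j → label (inj₁ v) ≡ p ⟨$⟩ˡ j
    label₁ {v} r = cong (p ⟨$⟩ˡ_) (Reach-unique A.Exits.injective (proj₂ (reach v)) r)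

    label₂ : ∀ {v j} → Reach Φ′.step-to F′.exit v j → label (inj₂ v) ≡ y ⟨$⟩ʳ j
    label₂ {v} r = cong (y ⟨$⟩ʳ_) (Reach-unique A′.Exits.injective (proj₂ (reach′ v)) r)

    label-entry : ∀ i → label (inj₁ (F.entry i)) ≡ i
    label-entry i = trans (label₁ (Φ.path⇒reach (p-route i))) (inverseˡ p)

    label-arc : ∀ i → label (start (arc i)) ≡ label (end (arc i))
    label-arc i with arc i in eq
    ... | inj₁ e = let j , r = reach (F.end e) in label₁ (step (λ k eq′ → A.start≢exit e k (sym eq′))
      (subst (λ v → Reach Φ.step-to F.exit v j) (sym (Φ.to-start (Z⊆K (i , eq)))) r))
    ... | inj₂ e = let j , r = reach′ (F′.end e) in label₂ (step (λ k eq′ → A′.start≢exit e k (sym eq′))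
      (subst (λ v → Reach Φ′.step-to F′.exit v j) (sym (Φ′.to-start (Z⊆K′ (i , eq)))) r))

    Linked : Vertex → Vertex → Set
    Linked u v = Joinable (σ ⟨$⟩ʳ_) (label u) (label v)

    -- Crossing from `F` to `F′` advances the label by `σ`, and crossing back keeps it. Arcs keep it
    -- too by `label-arc`, so a round of the cycle links all labels.
    ∼⇒Linked : ∀ {u v} → u ∼ v → Linked u v
    ∼⇒Linked = Eq.gfold (joinable-isEquivalence (σ ⟨$⟩ʳ_)) label glued
      where
      glued : ∀ {u v} → Glue F F′ x y u v → Linked u v
      glued (exit-entry′ i) = 1 , 0 , (begin
        σ ⟨$⟩ʳ label (inj₁ (F.exit i))       ≡⟨ cong (σ ⟨$⟩ʳ_) (label₁ (here refl)) ⟩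
        σ ⟨$⟩ʳ (p ⟨$⟩ˡ i)                    ≡⟨ cong (λ j → y ⟨$⟩ʳ (q ⟨$⟩ʳ (x ⟨$⟩ʳ j))) (inverseʳ p) ⟩
        y ⟨$⟩ʳ (q ⟨$⟩ʳ (x ⟨$⟩ʳ i))           ≡⟨ label₂ (Φ′.path⇒reach (q-route (x ⟨$⟩ʳ i))) ⟨
        label (inj₂ (F′.entry (x ⟨$⟩ʳ i)))   ∎)
      glued (exit′-entry i) = joinable-refl (σ ⟨$⟩ʳ_)
        (trans (label₂ (here refl)) (sym (label-entry (y ⟨$⟩ʳ i))))

    along : ∀ i → Linked (start (arc zero)) (start (arc i))
    along = next-closed⇒all (λ i → Linked (start (arc zero)) (start (arc i)))
      (λ i r → joinable-trans (σ ⟨$⟩ʳ_) r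
        (joinable-trans (σ ⟨$⟩ʳ_) (joinable-refl (σ ⟨$⟩ʳ_) (label-arc i)) (∼⇒Linked (consecutive i))))
      {zero} (joinable-refl (σ ⟨$⟩ʳ_) refl)

    everywhere : ∀ v → Linked (start (arc zero)) v
    everywhere v = let i , s∼ = proj₂ H v in joinable-trans (σ ⟨$⟩ʳ_) (along i) (∼⇒Linked s∼)

    -- The Hamiltonian cycle visits every entry vertex of `F`, and the label of `entry i` is `i`.
    transitive : ∀ i j → Joinable (σ ⟨$⟩ʳ_) i j
    transitive i j = subst₂ (Joinable (σ ⟨$⟩ʳ_)) (label-entry i) (label-entry j)
      (joinable-trans (σ ⟨$⟩ʳ_) (joinable-sym (σ ⟨$⟩ʳ_) (everywhere (inj₁ (F.entry i)))) (everywhere (inj₁ (F.entry j))))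

openRoutes⇒hamiltonian : (F F′ : TwoDigraph n) (x y : Permutation′ n) → n > 0 → ∀ {p q} →
  p ∈ OpenRoutes F → q ∈ OpenRoutes F′ → FullCycle (p ∘ₚ x ∘ₚ q ∘ₚ y) → Hamiltonian (splice F F′ x y)
openRoutes⇒hamiltonian {suc n} F F′ x y _ {p} {q} (K , K-open , p-route) (K′ , K′-open , q-route) =
  FromRoutes.hamiltonian F F′ x y K K′ K-open K′-open {p} {q} p-route q-route

hamiltonian⇒openRoutes : (F F′ : TwoDigraph n) (x y : Permutation′ n) → n > 0 → Hamiltonian (splice F F′ x y) →
  ∃₂ λ p q → p ∈ OpenRoutes F × q ∈ OpenRoutes F′ × FullCycle (p ∘ₚ x ∘ₚ q ∘ₚ y)
hamiltonian⇒openRoutes {suc n} F F′ x y _ H =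
  let K , K-open , Z⊆K     = hamiltonian⇒openFactor F F′ x y zero H
      H′ , H⊆H′            = hamiltonian-swap F F′ x y H
      K′ , K′-open , Z′⊆K′ = hamiltonian⇒openFactor F′ F y x zero H′
      p , p-route          = factor-route F K-open
      q , q-route          = factor-route F′ K′-open
  in p , q , (K , K-open , p-route) , (K′ , K′-open , q-route)
   , transitive⇒fullCycle (p ∘ₚ x ∘ₚ q ∘ₚ y)
       (FromHamiltonian.transitive F F′ x y H K-open K′-open Z⊆K (Z′⊆K′ ∘ H⊆H′) p q p-route q-route)

-- Full cycles, residues and parities

NoFullCycle : (P Q : PermSet n) (x y : Permutation′ n) → Set
NoFullCycle P Q x y = ∀ p q → p ∈ P → q ∈ Q → ¬ FullCycle (p ∘ₚ x ∘ₚ q ∘ₚ y)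

-- `q y` conjugates `q y p x` to `p x q y`: either way the composite is `q y p x q y`.
noFullCycle-swap : (P Q : PermSet n) (x y : Permutation′ n) → NoFullCycle P Q x y → NoFullCycle Q P y x
noFullCycle-swap P Q x y none q p q∈Q p∈P cycle = none p q p∈P q∈Q
  (fullCycle-conjugate (q ∘ₚ y) (q ∘ₚ y ∘ₚ p ∘ₚ x) (p ∘ₚ x ∘ₚ q ∘ₚ y) (λ _ → refl) cycle)

≢⇒≡⁻¹ : {p q : Parity} → p ≢ q → p ≡ q ⁻¹
≢⇒≡⁻¹ {0ℙ} {0ℙ} p≢q = contradiction refl p≢q
≢⇒≡⁻¹ {0ℙ} {1ℙ} p≢q = refl
≢⇒≡⁻¹ {1ℙ} {0ℙ} p≢q = refl
≢⇒≡⁻¹ {1ℙ} {1ℙ} p≢q = contradiction refl p≢q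

-- One formula for both cases of `Residue`: the required parity is odd when `P` and `n` have equal
-- parity and even otherwise. For `n > 0` it is also the parity of every `p⁻¹ c`, as a full cycle
-- has the parity of `n - 1`.
residue-intro : {P : PermSet n} (uP : Uniform P) {σ : Permutation′ n} →
  π σ ≡ (parityOf uP ℙ.+ parity n) ⁻¹ → ¬ Excluded P σ → Residue P uP σ
residue-intro {n} uP πσ σ∉E with parityOf uP ℙ.≟ parity n
... | yes eq = trans πσ (cong _⁻¹ (trans (cong (ℙ._+ parity n) eq) (ℙ.p+p≡0ℙ (parity n)))) , σ∉E
... | no neq = trans πσ (cong _⁻¹ (trans (cong (ℙ._+ parity n) (≢⇒≡⁻¹ neq)) (ℙ.p⁻¹+p≡1ℙ (parity n)))) , σ∉E

residue⇒∉excluded : {P : PermSet n} (uP : Uniform P) {σ : Permutation′ n} → Residue P uP σ → ¬ Excluded P σ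
residue⇒∉excluded {n} uP with parityOf uP ℙ.≟ parity n
... | yes _ = proj₂
... | no _  = proj₂

parityCondition-swap : {P Q : PermSet n} (uP : Uniform P) (uQ : Uniform Q) {x y : Permutation′ n} →
  ParityCondition n uP uQ x y → ParityCondition n uQ uP y x
parityCondition-swap uP uQ (inj₁ (n0 , PQ , xy))               = inj₁ (n0 , sym PQ , ≢-sym xy)
parityCondition-swap uP uQ (inj₂ (inj₁ (n0 , PQ , xy)))        = inj₂ (inj₁ (n0 , ≢-sym PQ , sym xy))
parityCondition-swap uP uQ (inj₂ (inj₂ (inj₁ (n1 , PQ , xy)))) = inj₂ (inj₂ (inj₁ (n1 , sym PQ , sym xy)))
parityCondition-swap uP uQ (inj₂ (inj₂ (inj₂ (n1 , PQ , xy)))) = inj₂ (inj₂ (inj₂ (n1 , ≢-sym PQ , ≢-sym xy)))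

x⁻¹-q-x : ∀ x q → x ⁻¹ ℙ.+ (q ℙ.+ x) ≡ q ⁻¹
x⁻¹-q-x 0ℙ 0ℙ = refl
x⁻¹-q-x 0ℙ 1ℙ = refl
x⁻¹-q-x 1ℙ 0ℙ = refl
x⁻¹-q-x 1ℙ 1ℙ = refl

x-q-x : ∀ x q → x ℙ.+ (q ℙ.+ x) ≡ q
x-q-x 0ℙ 0ℙ = refl
x-q-x 0ℙ 1ℙ = refl
x-q-x 1ℙ 0ℙ = refl
x-q-x 1ℙ 1ℙ = refl

-- The four cases together say that the parities of `n`, `P`, `Q`, `x` and `y` add up to `1ℙ`; here
-- that equation is solved for the parity of `x q y`.
parityCondition⇒parity : {P Q : PermSet n} (uP : Uniform P) (uQ : Uniform Q) {x y : Permutation′ n} →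
  ParityCondition n uP uQ x y → π x ℙ.+ (parityOf uQ ℙ.+ π y) ≡ (parityOf uP ℙ.+ parity n) ⁻¹
parityCondition⇒parity {n} uP uQ {x} {y} = λ
  { (inj₁ (n0 , PQ , xy))               → flipped (≢⇒≡⁻¹ xy) (trans (plus-0 n0) PQ)
  ; (inj₂ (inj₁ (n0 , PQ , xy)))        → kept xy (trans (plus-0 n0) (≢⇒≡⁻¹ PQ))
  ; (inj₂ (inj₂ (inj₁ (n1 , PQ , xy)))) → kept xy (trans (plus-1 n1) (cong _⁻¹ PQ))
  ; (inj₂ (inj₂ (inj₂ (n1 , PQ , xy)))) → flipped (≢⇒≡⁻¹ xy) (trans (plus-1 n1) (sym (≢⇒≡⁻¹ (≢-sym PQ)))) }
  where
  plus-0 : parity n ≡ 0ℙ → parityOf uP ℙ.+ parity n ≡ parityOf uP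
  plus-0 n0 = trans (cong (parityOf uP ℙ.+_) n0) (ℙ.+-identityʳ _)
  plus-1 : parity n ≡ 1ℙ → parityOf uP ℙ.+ parity n ≡ parityOf uP ⁻¹
  plus-1 n1 = trans (cong (parityOf uP ℙ.+_) n1) (ℙ.+-comm (parityOf uP) 1ℙ)
  flipped : π x ≡ π y ⁻¹ → parityOf uP ℙ.+ parity n ≡ parityOf uQ →
    π x ℙ.+ (parityOf uQ ℙ.+ π y) ≡ (parityOf uP ℙ.+ parity n) ⁻¹
  flipped xy Pn = trans (cong (ℙ._+ (parityOf uQ ℙ.+ π y)) xy)
    (trans (x⁻¹-q-x (π y) (parityOf uQ)) (cong _⁻¹ (sym Pn)))
  kept : π x ≡ π y → parityOf uP ℙ.+ parity n ≡ parityOf uQ ⁻¹ →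
    π x ℙ.+ (parityOf uQ ℙ.+ π y) ≡ (parityOf uP ℙ.+ parity n) ⁻¹
  kept xy Pn = trans (cong (ℙ._+ (parityOf uQ ℙ.+ π y)) xy)
    (trans (x-q-x (π y) (parityOf uQ)) (trans (sym (ℙ.⁻¹-involutive _)) (cong _⁻¹ (sym Pn))))

module _ {P Q : PermSet n} (uP : Uniform P) (uQ : Uniform Q) (x y : Permutation′ n) where

  -- If `c = p x q y` were a full cycle, then `x q y = p⁻¹ c` would be an excluded element of
  -- `x Q y`.
  translate⊆residue⇒noFullCycle : translate x Q y ⊆ Residue P uP → NoFullCycle P Q x y
  translate⊆residue⇒noFullCycle xQy⊆R p q p∈P q∈Q cycle =
    residue⇒∉excluded uP {x ∘ₚ q ∘ₚ y} (xQy⊆R {x ∘ₚ q ∘ₚ y} (q , q∈Q , λ _ → refl))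
      (p , p ∘ₚ x ∘ₚ q ∘ₚ y , p∈P , cycle , λ i → cong (λ j → y ⟨$⟩ʳ (q ⟨$⟩ʳ (x ⟨$⟩ʳ j))) (sym (inverseʳ p)))

  noFullCycle⇒translate⊆residue : ParityCondition n uP uQ x y → NoFullCycle P Q x y →
    translate x Q y ⊆ Residue P uP
  noFullCycle⇒translate⊆residue condition none {σ} (q , q∈Q , σ≈xqy) =
    residue-intro uP {σ} πσ λ (p , c , p∈P , cycle , σ≈p⁻¹c) →
      -- Conjugation by `id` transports `FullCycle` along the pointwise equality of `c` and
      -- `p x q y`.
      none p q p∈P q∈Q (fullCycle-conjugate id c (p ∘ₚ x ∘ₚ q ∘ₚ y)
        (λ i → trans (sym (σ≈xqy (p ⟨$⟩ʳ i))) (trans (σ≈p⁻¹c (p ⟨$⟩ʳ i)) (cong (c ⟨$⟩ʳ_) (inverseˡ p)))) cycle)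
    where
    πσ : π σ ≡ (parityOf uP ℙ.+ parity n) ⁻¹
    πσ = begin
      π σ                               ≡⟨ π-cong {σ = σ} {x ∘ₚ q ∘ₚ y} σ≈xqy ⟩
      π (x ∘ₚ q ∘ₚ y)                   ≡⟨ π-∘ x (q ∘ₚ y) ⟩
      π x ℙ.+ π (q ∘ₚ y)                ≡⟨ cong (π x ℙ.+_) (π-∘ q y) ⟩
      π x ℙ.+ (π q ℙ.+ π y)             ≡⟨ cong (λ a → π x ℙ.+ (a ℙ.+ π y)) (Uniform.uniform uQ {q} q∈Q) ⟩
      π x ℙ.+ (parityOf uQ ℙ.+ π y)     ≡⟨ parityCondition⇒parity uP uQ {x} {y} condition ⟩
      _                                 ∎

theorem1 : (n : ℕ) → n > 0 →
           (F F′ : TwoDigraph n) →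
           Connected (TwoDigraph.digraph F) → Connected (TwoDigraph.digraph F′) →
           Open (TwoDigraph.digraph F) → Open (TwoDigraph.digraph F′) →
           AllACsOdd (TwoDigraph.digraph F) → AllACsOdd (TwoDigraph.digraph F′) →
           (x y : Permutation′ n) →
           let P = OpenRoutes F
               Q = OpenRoutes F′
               G = splice F F′ x y
           in Σ[ uP ∈ Uniform P ] Σ[ uQ ∈ Uniform Q ]
              (ParityCondition n uP uQ x y →
                 ((¬ Hamiltonian G) ⇔ (translate x Q y ⊆ Residue P uP))
               × ((translate x Q y ⊆ Residue P uP) ⇔ (translate y P x ⊆ Residue Q uQ)))
theorem1 n n>0 F F′ _ _ F-open F′-open F-odd F′-odd x y = uP , uQ , λ condition →
    -- Both equivalences pass through `NoFullCycle`; (iii) is reached through the version with the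
    -- two sides exchanged, for which the parity condition is exchanged as well.
    mk⇔ (λ ¬H {σ} → ii⇐ condition (¬H⇒none ¬H) {σ}) (λ xQy⊆R → none⇒¬H (ii⇒ (λ {σ} → xQy⊆R {σ})))
  , mk⇔ (λ xQy⊆R {σ} → iii⇐ (parityCondition-swap uP uQ {x} {y} condition)
                         (noFullCycle-swap P Q x y (ii⇒ (λ {τ} → xQy⊆R {τ}))) {σ})
        (λ yPx⊆R {σ} → ii⇐ condition (noFullCycle-swap Q P y x (iii⇒ (λ {τ} → yPx⊆R {τ}))) {σ})
  where
  P  = OpenRoutes F
  Q  = OpenRoutes F′
  uP = openRoutes-uniform F F-open F-odd
  uQ = openRoutes-uniform F′ F′-open F′-odd
  ii⇒  = translate⊆residue⇒noFullCycle uP uQ x y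
  ii⇐  = noFullCycle⇒translate⊆residue uP uQ x y
  iii⇒ = translate⊆residue⇒noFullCycle uQ uP y x
  iii⇐ = noFullCycle⇒translate⊆residue uQ uP y x
  ¬H⇒none : ¬ Hamiltonian (splice F F′ x y) → NoFullCycle P Q x y
  ¬H⇒none ¬H p q p∈P q∈Q cycle = ¬H (openRoutes⇒hamiltonian F F′ x y n>0 {p} {q} p∈P q∈Q cycle)
  none⇒¬H : NoFullCycle P Q x y → ¬ Hamiltonian (splice F F′ x y)
  none⇒¬H none H = let p , q , p∈P , q∈Q , cycle = hamiltonian⇒openRoutes F F′ x y n>0 H in none p q p∈P q∈Q cycle
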